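{- Let $\mathcal H=(V,E)$ be a connected hypergraph with a fixed ribbon structure, base node $b_0$ and base edge $b_0b_1$ on $\mathrm{Bip}\,\mathcal H$. Run the (ht:$E$, cut:$V$) Bernardi process on a hypertree $\mathbf f$ on $E$ and let $T$ be the resulting spanning tree. Then running the (ht:$E$, cut:$E$) Bernardi process on $\mathbf f$, with base node $b_0$, base edge $b_0b_1^-$, and the reversed ribbon structure, also results in $T$.
   Context: $\mathcal H=(V,E)$: $V$ finite set, $E$ finite multiset of nonempty subsets of $V$; $\mathrm{Bip}\,\mathcal H$ has color classes $V$ (violet) and $E$ (emerald), $v$ joined to $e$ iff $v\in e$; connected means $\mathrm{Bip}\,\mathcal H$ connected. A ribbon structure assigns to each node $x$ a cyclic permutation of its incident edges; $xy^+$ (resp. $xy^-$) is the edge following (resp. preceding) $xy$ at $x$; subgraphs inherit restricted orders ($xy^+_G$ in subgraph $G$). The reversed ribbon structure inverts every cyclic permutation; $b_0b_1^-$ refers to the original structure. A hypertree on $E$ is $\mathbf f:E\to\mathbb Z_{\ge0}$ such that some spanning tree $T$ has $d_T(e)=\mathbf f(e)+1$ for all $e\in E$. Bernardi processes with hypertree $\mathbf f$ on $E$ and base node $b_0$, base edge $b_0b_1$ (for the given ribbon structure); current graph $G$ initially $\mathrm{Bip}\,\mathcal H$; outcome = final current graph. (ht:$E$, cut:$V$): if $b_0\in V$ start with current edge $b_0b_1$; if $b_0\in E$ start with $b_1b_0^+$, $b_0b_1$ counting as traversed from $b_0$. With current edge $ve$ ($v\in V$): if $\mathbf f$ is a hypertree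 on $E$ in $G-ve$, remove $ve$ and make $ve^+_G$ current; otherwise traverse $ve$ from $v$ and $ew:=ev^+_G$ from $e$, and make $we^+_G$ current. (ht:$E$, cut:$E$): if $b_0\in E$ start with $b_0b_1$; if $b_0\in V$ start with $b_1b_0^+$, $b_0b_1$ counting as traversed from $b_0$. With current edge $ev$ ($e\in E$): if $\mathbf f$ is a hypertree on $E$ in $G-ev$, remove $ev$ and make $ev^+_G$ current; otherwise traverse $ev$ from $e$ and $vd:=ve^+_G$ from $v$, and make $dv^+_G$ current. Each process stops right before an edge would be traversed a second time from the same endpoint. -}

module Defs where

open import Data.Nat using (ℕ; zero; suc; _≤_; _+_)
open import Data.Bool using (Bool; true; false; if_then_else_; _∧_)
open import Data.Fin using (Fin; zero; suc)
open import Data.Fin.Properties using (_≟_)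
open import Data.Sum using (_⊎_; inj₁; inj₂)
open import Data.Product using (Σ; _×_; _,_; ∃)
open import Data.Empty using (⊥)
open import Data.Maybe using (Maybe; just; nothing)
open import Data.List using (List; []; _∷_; _++_; reverse; length; [_])
open import Data.List.Membership.Propositional using (_∈_; _∉_)
open import Data.List.Relation.Unary.Unique.Propositional using (Unique)
open import Relation.Nullary using (¬_; does)
open import Relation.Binary.PropositionalEquality using (_≡_)
open import Relation.Binary.Construct.Closure.ReflexiveTransitive using (Star)
open import Function.Bundles using (_⇔_)

-- Hypergraph H = (V, E) with V = Fin n (violet), E = Fin m (emerald).
-- E is a multiset of subsets of V: hyperedge e is the set {v | inc v e ≡ true}.
-- A "graph" on the node set of Bip H is a set of bipartite edges v–e,
-- given as a Boolean matrix. Bip H itself is the matrix inc.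

Graph : ℕ → ℕ → Set
Graph n m = Fin n → Fin m → Bool

Node : ℕ → ℕ → Set
Node n m = Fin n ⊎ Fin m

Adj : ∀ {n m} → Graph n m → Node n m → Node n m → Set
Adj G (inj₁ v) (inj₂ e) = G v e ≡ true
Adj G (inj₂ e) (inj₁ v) = G v e ≡ true
Adj G (inj₁ _) (inj₁ _) = ⊥
Adj G (inj₂ _) (inj₂ _) = ⊥

Connected : ∀ {n m} → Graph n m → Set
Connected {n} {m} G = (x y : Node n m) → Star (Adj G) x y

Chain : ∀ {n m} → Graph n m → List (Node n m) → Set
Chain G [] = Data.Unit.⊤ where import Data.Unit
Chain G (x ∷ []) = Data.Unit.⊤ where import Data.Unit
Chain G (x ∷ y ∷ xs) = Adj G x y × Chain G (y ∷ xs)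

IsCycle : ∀ {n m} → Graph n m → List (Node n m) → Set
IsCycle G [] = ⊥
IsCycle G (x ∷ xs) = Unique (x ∷ xs) × 3 ≤ length (x ∷ xs) × Chain G (x ∷ xs ++ [ x ])

Acyclic : ∀ {n m} → Graph n m → Set
Acyclic {n} {m} G = (c : List (Node n m)) → ¬ IsCycle G c

_⊆G_ : ∀ {n m} → Graph n m → Graph n m → Set
T ⊆G G = ∀ v e → T v e ≡ true → G v e ≡ true

SpanningTree : ∀ {n m} → Graph n m → Graph n m → Set
SpanningTree G T = T ⊆G G × Connected T × Acyclic T

countTrue : ∀ {k} → (Fin k → Bool) → ℕ
countTrue {zero} p = 0
countTrue {suc k} p = (if p zero then 1 else 0) + countTrue (λ i → p (suc i))

degE : ∀ {n m} → Graph n m → Fin m → ℕ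
degE T e = countTrue (λ v → T v e)

IsHypertree : ∀ {n m} → Graph n m → (Fin m → ℕ) → Set
IsHypertree G f = ∃ λ T → SpanningTree G T × (∀ e → degE T e ≡ suc (f e))

del : ∀ {n m} → Graph n m → Fin n → Fin m → Graph n m
del G v e v' e' = if does (v' ≟ v) ∧ does (e' ≟ e) then false else G v' e'

-- Ribbon structures. The cyclic order at a node is a duplicate-free list of
-- its neighbours (equivalently, of its incident edges), read cyclically.

IsRibbon : ∀ {n m} → Graph n m → (Fin n → List (Fin m)) → (Fin m → List (Fin n)) → Set
IsRibbon {n} {m} inc ordV ordE =
  (∀ v → Unique (ordV v) × (∀ e → (e ∈ ordV v) ⇔ (inc v e ≡ true))) ×
  (∀ e → Unique (ordE e) × (∀ v → (v ∈ ordE e) ⇔ (inc v e ≡ true)))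

-- rotateAfter xs a = the elements of the cyclic list xs starting right after a,
-- ending with a itself (empty if a ∉ xs)
rotateAfter : ∀ {k} → List (Fin k) → Fin k → List (Fin k)
rotateAfter {k} xs a = go [] xs
  where
  go : List (Fin k) → List (Fin k) → List (Fin k)
  go acc [] = []
  go acc (y ∷ ys) = if does (y ≟ a) then ys ++ reverse acc ++ [ a ] else go (y ∷ acc) ys

firstWith : ∀ {k} → (Fin k → Bool) → List (Fin k) → Maybe (Fin k)
firstWith p [] = nothing
firstWith p (y ∷ ys) = if p y then just y else firstWith p ys

-- next ord a p : the neighbour following a in the cyclic order `ord`,
-- restricted to the neighbours satisfying p (the current subgraph).
-- For x a node with cyclic order ord_x, xa⁺_G corresponds to
-- next ord_x a (neighbours of x in G).
next : ∀ {k} → List (Fin k) → Fin k → (Fin k → Bool) → Maybe (Fin k)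
next xs a p = firstWith p (rotateAfter xs a)

-- Traversal records: edge v–e traversed from v (fromV) or from e (fromE)

data Side : Set where
  fromV fromE : Side

Trav : ℕ → ℕ → Set
Trav n m = List (Fin n × Fin m × Side)

module Processes {n m : ℕ} (inc : Graph n m) (f : Fin m → ℕ)
                 (ordV : Fin n → List (Fin m)) (ordE : Fin m → List (Fin n)) where

  -- (ht:E, cut:V): state = current graph G, traversals, current edge v–e
  -- (viewed from v); the last index is the outcome.
  data Run1 (G : Graph n m) (tr : Trav n m) (v : Fin n) (e : Fin m) : Graph n m → Set where
    remove : ∀ {e' out} → IsHypertree (del G v e) f →
             next (ordV v) e (del G v e v) ≡ just e' →
             Run1 (del G v e) tr v e' out → Run1 G tr v e out
    stop1  : ¬ IsHypertree (del G v e) f → (v , e , fromV) ∈ tr → Run1 G tr v e G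
    stop2  : ∀ {w} → ¬ IsHypertree (del G v e) f → (v , e , fromV) ∉ tr →
             next (ordE e) v (λ x → G x e) ≡ just w →
             (w , e , fromE) ∈ ((v , e , fromV) ∷ tr) → Run1 G tr v e G
    step   : ∀ {w e' out} → ¬ IsHypertree (del G v e) f → (v , e , fromV) ∉ tr →
             next (ordE e) v (λ x → G x e) ≡ just w →
             (w , e , fromE) ∉ ((v , e , fromV) ∷ tr) →
             next (ordV w) e (G w) ≡ just e' →
             Run1 G ((w , e , fromE) ∷ (v , e , fromV) ∷ tr) w e' out →
             Run1 G tr v e out

  -- (ht:E, cut:E): current edge e–v (viewed from e)
  data Run2 (G : Graph n m) (tr : Trav n m) (e : Fin m) (v : Fin n) : Graph n m → Set where
    remove : ∀ {v' out} → IsHypertree (del G v e) f →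
             next (ordE e) v (λ x → del G v e x e) ≡ just v' →
             Run2 (del G v e) tr e v' out → Run2 G tr e v out
    stop1  : ¬ IsHypertree (del G v e) f → (v , e , fromE) ∈ tr → Run2 G tr e v G
    stop2  : ∀ {d} → ¬ IsHypertree (del G v e) f → (v , e , fromE) ∉ tr →
             next (ordV v) e (G v) ≡ just d →
             (v , d , fromV) ∈ ((v , e , fromE) ∷ tr) → Run2 G tr e v G
    step   : ∀ {d v' out} → ¬ IsHypertree (del G v e) f → (v , e , fromE) ∉ tr →
             next (ordV v) e (G v) ≡ just d →
             (v , d , fromV) ∉ ((v , e , fromE) ∷ tr) →
             next (ordE d) v (λ x → G x d) ≡ just v' →
             Run2 G ((v , d , fromV) ∷ (v , e , fromE) ∷ tr) d v' out →
             Run2 G tr e v out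

  data Outcome1 : Node n m → Node n m → Graph n m → Set where
    baseV : ∀ {v e T} → Run1 inc [] v e T → Outcome1 (inj₁ v) (inj₂ e) T
    baseE : ∀ {e v e' T} → next (ordV v) e (inc v) ≡ just e' →
            Run1 inc ((v , e , fromE) ∷ []) v e' T → Outcome1 (inj₂ e) (inj₁ v) T

  data Outcome2 : Node n m → Node n m → Graph n m → Set where
    baseE : ∀ {e v T} → Run2 inc [] e v T → Outcome2 (inj₂ e) (inj₁ v) T
    baseV : ∀ {v e v' T} → next (ordE e) v (λ x → inc x e) ≡ just v' →
            Run2 inc ((v , e , fromV) ∷ []) e v' T → Outcome2 (inj₁ v) (inj₂ e) T

revV : ∀ {n m} → (Fin n → List (Fin m)) → Fin n → List (Fin m)
revV ordV v = reverse (ordV v)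

revE : ∀ {n m} → (Fin m → List (Fin n)) → Fin m → List (Fin n)
revE ordE e = reverse (ordE e)

-- b0 b1⁻ : the neighbour b1' of b0 such that b0b1' precedes b0b1 at b0 in the
-- ORIGINAL ribbon structure
PrevBase : ∀ {n m} → Graph n m → (Fin n → List (Fin m)) → (Fin m → List (Fin n)) →
           Node n m → Node n m → Node n m → Set
PrevBase inc ordV ordE (inj₁ v) (inj₂ e) (inj₂ e') =
  next (reverse (ordV v)) e (inc v) ≡ just e'
PrevBase inc ordV ordE (inj₂ e) (inj₁ v) (inj₁ v') =
  next (reverse (ordE e)) v (λ x → inc x e) ≡ just v'
PrevBase inc ordV ordE _ _ _ = ⊥

IsConnectedHypergraph : ∀ {n m} → Graph n m → Set
IsConnectedHypergraph {n} {m} inc = (∀ e → ∃ λ (v : Fin n) → inc v e ≡ true) × Connected inc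

{-# OPTIONS --safe #-}
module Submission where

-- The tour of a spanning tree J steps cyclically through the darts (edge, endpoint) at a
-- node and crosses to the other endpoint at edges of J.  It visits every dart once per period.
-- Among the spanning trees realizing f there is one, J, whose tour meets each non-tree edge
-- at its violet end first: at the first violation, a non-tree edge we met at e, replace the edge
-- of the tree at e pointing towards w by we.  This increases, lexicographically along the
-- tour, the word that rewards non-tree edges met at violet and tree edges met at emerald nodes.
--
-- The (ht:E, cut:V) process follows the tour of J.  A non-tree edge may be removed since J
-- survives.  Suppose a tree edge xy is checked at x.  By the order of first visits, all the
-- other edges of the current graph crossing the cut of J - xy have their emerald end on the
-- same side, namely that of the violet end of xy, and counting the edges at the emerald nodes
-- of the opposite side shows that no spanning tree of the current graph without xy realizes f.
--
-- The tour for the reversed ribbon structure from b₀b₁⁻ is the same tour read backwards, with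
-- the tree darts flipped.  So it meets each non-tree edge at its emerald end first, and the
-- same argument shows that the (ht:E, cut:E) process follows it and returns J.

open import Defs
open import Data.Bool using (Bool; true; false; not; if_then_else_; _∧_; _xor_)
open import Data.Bool.Properties using (¬-not; ∧-conicalˡ; ∧-conicalʳ) renaming (_≟_ to _≟B_)
open import Data.Empty using (⊥)
open import Data.Fin using (Fin; zero; suc; combine; toℕ)
open import Data.Fin.Properties using (_≟_; pigeonhole; combine-injective; toℕ<n; suc-injective)
open import Data.List using (List; []; _∷_; _++_; reverse; [_]; head)
open import Data.List.Membership.DecPropositional using () renaming (_∈?_ to member?)
open import Data.List.Membership.Propositional using (_∈_; _∉_)
open import Data.List.Membership.Propositional.Properties using (∈-++⁺ˡ; ∈-++⁺ʳ; ∈-++⁻)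
open import Data.List.Properties using (++-assoc; ++-identityʳ; reverse-++; unfold-reverse)
open import Data.List.Relation.Unary.All as All using (All; []; _∷_)
open import Data.List.Relation.Unary.All.Properties using (¬Any⇒All¬)
open import Data.List.Relation.Unary.AllPairs using ([]; _∷_)
open import Data.List.Relation.Unary.Any using (here; there)
open import Data.List.Relation.Unary.Any.Properties using (reverse⁺; reverse⁻)
open import Data.List.Relation.Unary.Unique.Propositional using (Unique)
open import Data.List.Relation.Unary.Unique.Propositional.Properties using (++⁺)
open import Data.Maybe using (just; fromMaybe)
open import Data.Nat using (ℕ; zero; suc; z≤n; s≤s; z<s; s<s; _≤_; _<_; _+_; _*_; _∸_; _^_; _≤?_; _<?_)
open import Data.Nat.Induction using (<-wellFounded)
open import Data.Nat.Properties using
  ( ≤-refl; ≤-reflexive; ≤-trans; ≤-antisym; ≤-pred; <-irrefl; <-trans; <-≤-trans; ≤-<-trans; <-cmp; <⇒≤; <⇒≢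
  ; ≮⇒≥; ≰⇒>; n<1+n; m≤n⇒m≤1+n; m≤n⇒m<n∨m≡n; m≤m+n; m≤n+m; +-suc; +-comm; +-identityʳ; +-cancelʳ-≡
  ; +-mono-≤; +-mono-≤-<; +-monoʳ-<; m∸n≤m; m∸n+n≡m; m+[n∸m]≡n; m+n∸n≡m; m+n∸m≡n; m<n⇒0<n∸m
  ; ∸-monoˡ-≤; ∸-monoʳ-≤; ∸-monoʳ-<; +-0-commutativeMonoid; anyUpTo?; module ≤-Reasoning )
open import Data.Product using (Σ; _×_; _,_; ∃; ∃₂; proj₁; proj₂)
open import Data.Product.Properties using () renaming (≡-dec to ×-≡-dec)
open import Data.Sum using (_⊎_; inj₁; inj₂)
open import Data.Sum.Properties using () renaming (≡-dec to ⊎-≡-dec)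
open import Data.Unit using (tt)
open import Function using (_∘_)
open import Function.Bundles using (_⇔_; mk⇔; Equivalence)
open import Induction.WellFounded using (Acc; acc)
open import Relation.Binary using (DecidableEquality; tri<; tri≈; tri>)
open import Relation.Binary.Construct.Closure.ReflexiveTransitive using (Star; ε; _◅_; _◅◅_; gmap)
open import Relation.Binary.PropositionalEquality hiding ([_])
open import Relation.Nullary using (¬_; Dec; yes; no; contradiction)
open import Relation.Nullary.Decidable using (does; dec-true; dec-false; decidable-stable; ¬?; _×-dec_; _⊎-dec_)
open import Algebra.Properties.CommutativeMonoid.Sum +-0-commutativeMonoid
  using (sum; sum-cong-≗; ∑-distrib-+; ∑-comm)

-- Cyclic lists

-- rotateAfter is defined through a local worker function that cannot be named
-- from outside; the equation in the second clause identifies the worker.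
mutual
  rotateWorker : ∀ {k} → List (Fin k) → Fin k → List (Fin k) → List (Fin k) → List (Fin k)
  rotateWorker = _

  rotateWorker-spec : ∀ {k} (b : Fin k) xs a → b ≢ a →
                      rotateAfter (b ∷ xs) a ≡ rotateWorker (b ∷ xs) a (b ∷ []) xs
  rotateWorker-spec b xs a b≢a with b ≟ a
  ... | yes b≡a = contradiction b≡a b≢a
  ... | no _ with b List.∷ xs | [ b ]
  ... | zs | seen = refl

rotateWorker-split : ∀ {k} (zs : List (Fin k)) (a : Fin k) seen l r → a ∉ l →
                     rotateWorker zs a seen (l ++ a ∷ r) ≡ r ++ reverse seen ++ l ++ [ a ]
rotateWorker-split zs a seen [] r a∉l with a ≟ a
... | yes _  = refl
... | no a≢a = contradiction refl a≢a
rotateWorker-split zs a seen (y ∷ l) r a∉l with y ≟ a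
... | yes refl = contradiction (here refl) a∉l
... | no _ = begin
  rotateWorker zs a (y ∷ seen) (l ++ a ∷ r)
    ≡⟨ rotateWorker-split zs a (y ∷ seen) l r (λ a∈l → a∉l (there a∈l)) ⟩
  r ++ reverse (y ∷ seen) ++ l ++ [ a ]
    ≡⟨ cong (λ zs → r ++ zs ++ l ++ [ a ]) (unfold-reverse y seen) ⟩
  r ++ (reverse seen ++ [ y ]) ++ l ++ [ a ]
    ≡⟨ cong (r ++_) (++-assoc (reverse seen) [ y ] (l ++ [ a ])) ⟩
  r ++ reverse seen ++ y ∷ l ++ [ a ] ∎
  where open ≡-Reasoning

rotateAfter-split : ∀ {k} (a : Fin k) l r → a ∉ l → rotateAfter (l ++ a ∷ r) a ≡ r ++ l ++ [ a ]
rotateAfter-split a l r = rotateWorker-split (l ++ a ∷ r) a [] l r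

∈-split-first : ∀ {k} {a : Fin k} {xs} → a ∈ xs → ∃₂ λ l r → xs ≡ l ++ a ∷ r × a ∉ l
∈-split-first {a = a} {x ∷ xs} a∈ with x ≟ a
... | yes refl = [] , xs , refl , λ ()
∈-split-first (here refl) | no x≢a = contradiction refl x≢a
∈-split-first {xs = x ∷ _} (there a∈) | no x≢a with ∈-split-first a∈
... | l , r , refl , a∉l = x ∷ l , r , refl , λ { (here a≡x) → x≢a (sym a≡x) ; (there a∈l) → a∉l a∈l }

Unique-∉ˡ : ∀ {A : Set} {a : A} l {r} → Unique (l ++ a ∷ r) → a ∉ l
Unique-∉ˡ (x ∷ l) (x≢ ∷ _) (here refl) = All.lookup x≢ (∈-++⁺ʳ l (here refl)) refl
Unique-∉ˡ (x ∷ l) (_ ∷ u) (there a∈l) = Unique-∉ˡ l u a∈l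

Unique-reverse : ∀ {A : Set} {xs : List A} → Unique xs → Unique (reverse xs)
Unique-reverse [] = []
Unique-reverse {xs = x ∷ xs} (x≢ ∷ u) rewrite unfold-reverse x xs =
  ++⁺ (Unique-reverse u) ([] ∷ [])
      λ { (x∈ , here refl) → All.lookup x≢ (reverse⁻ x∈) refl }

-- Passing to the successor moves the head to the end. The cases are `a` followed by an entry, `a`
-- alone, and `a` in last place, where the successor is the first entry.
rotateAfter-step : ∀ {k} {xs : List (Fin k)} {a b bs} → Unique xs → a ∈ xs →
                   rotateAfter xs a ≡ b ∷ bs → rotateAfter xs b ≡ bs ++ [ b ]
rotateAfter-step {a = a} {b} u a∈ eq with ∈-split-first a∈
... | l , r , refl , a∉l with trans (sym (rotateAfter-split a l r a∉l)) eq
rotateAfter-step {a = a} {b} u a∈ eq | l , b ∷ r , refl , a∉l | refl = begin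
  rotateAfter (l ++ a ∷ b ∷ r) b       ≡⟨ cong (λ zs → rotateAfter zs b) assoc ⟨
  rotateAfter ((l ++ [ a ]) ++ b ∷ r) b ≡⟨ rotateAfter-split b (l ++ [ a ]) r (Unique-∉ˡ _ (subst Unique (sym assoc) u)) ⟩
  r ++ (l ++ [ a ]) ++ [ b ]           ≡⟨ ++-assoc r (l ++ [ a ]) [ b ] ⟨
  (r ++ l ++ [ a ]) ++ [ b ]           ∎
  where
  open ≡-Reasoning
  assoc = ++-assoc l [ a ] (b ∷ r)
rotateAfter-step u a∈ eq | [] , [] , refl , a∉l | refl = eq
rotateAfter-step {a = a} u a∈ eq | b ∷ l , [] , refl , a∉l | refl = rotateAfter-split b [] (l ++ [ a ]) λ ()

∈-rotateAfter : ∀ {k} {xs : List (Fin k)} {a c} → a ∈ xs → c ∈ xs → c ∈ rotateAfter xs a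
∈-rotateAfter {a = a} a∈ c∈ with ∈-split-first a∈
... | l , r , refl , a∉l rewrite rotateAfter-split a l r a∉l with ∈-++⁻ l c∈
... | inj₁ c∈l          = ∈-++⁺ʳ r (∈-++⁺ˡ c∈l)
... | inj₂ (here refl)  = ∈-++⁺ʳ r (∈-++⁺ʳ l (here refl))
... | inj₂ (there c∈r)  = ∈-++⁺ˡ c∈r

rotateAfter-⊆ : ∀ {k} {xs : List (Fin k)} {a c} → a ∈ xs → c ∈ rotateAfter xs a → c ∈ xs
rotateAfter-⊆ {a = a} a∈ c∈ with ∈-split-first a∈
... | l , r , refl , a∉l rewrite rotateAfter-split a l r a∉l with ∈-++⁻ r c∈
... | inj₁ c∈r = ∈-++⁺ʳ l (there c∈r)
... | inj₂ c∈la with ∈-++⁻ l c∈la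
... | inj₁ c∈l = ∈-++⁺ˡ c∈l
... | inj₂ (here refl) = ∈-++⁺ʳ l (here refl)

-- The default `a` makes the successor total; for `a ∈ xs` the rotated list is nonempty.
cyclicSuc : ∀ {k} → List (Fin k) → Fin k → Fin k
cyclicSuc xs a = fromMaybe a (head (rotateAfter xs a))

rotateAfter-∷ : ∀ {k} {xs : List (Fin k)} {a} → a ∈ xs → ∃ λ bs → rotateAfter xs a ≡ cyclicSuc xs a ∷ bs
rotateAfter-∷ {xs = xs} {a} a∈ with rotateAfter xs a | ∈-rotateAfter a∈ a∈
... | b ∷ bs | _ = bs , refl

cyclicSuc-∈ : ∀ {k} {xs : List (Fin k)} {a} → a ∈ xs → cyclicSuc xs a ∈ xs
cyclicSuc-∈ {xs = xs} {a} a∈ with rotateAfter-∷ a∈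
... | bs , eq = rotateAfter-⊆ a∈ (subst (cyclicSuc xs a ∈_) (sym eq) (here refl))

cyclicSuc-eq : ∀ {k} {xs : List (Fin k)} {a b bs} → rotateAfter xs a ≡ b ∷ bs → cyclicSuc xs a ≡ b
cyclicSuc-eq eq rewrite eq = refl

cyclicSuc-next : ∀ {k} l {a b : Fin k} {r} → Unique (l ++ a ∷ b ∷ r) → cyclicSuc (l ++ a ∷ b ∷ r) a ≡ b
cyclicSuc-next l {a} {b} {r} u = cyclicSuc-eq {xs = l ++ a ∷ b ∷ r} (rotateAfter-split _ l _ (Unique-∉ˡ l u))

cyclicSuc-wrap : ∀ {k} {a b : Fin k} l → Unique (b ∷ l ++ [ a ]) → cyclicSuc (b ∷ l ++ [ a ]) a ≡ b
cyclicSuc-wrap {a = a} {b} l u = cyclicSuc-eq {xs = b ∷ l ++ [ a ]} (rotateAfter-split _ (b ∷ l) [] (Unique-∉ˡ (b ∷ l) u))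

-- Neighbouring entries `a`, `b` become `b`, `a` in the reversed list. A singleton and a pair that
-- wraps around the end are treated apart.
cyclicSuc-reverse : ∀ {k} {xs : List (Fin k)} {a} → Unique xs → a ∈ xs →
                    cyclicSuc (reverse xs) (cyclicSuc xs a) ≡ a
cyclicSuc-reverse {a = a} u a∈ with ∈-split-first a∈
cyclicSuc-reverse {a = a} u a∈ | l , b ∷ r , refl , _ = begin
  cyclicSuc (reverse (l ++ a ∷ b ∷ r)) (cyclicSuc (l ++ a ∷ b ∷ r) a)
    ≡⟨ cong₂ cyclicSuc rev (cyclicSuc-next l u) ⟩
  cyclicSuc (reverse r ++ b ∷ a ∷ reverse l) b
    ≡⟨ cyclicSuc-next (reverse r) (subst Unique rev (Unique-reverse u)) ⟩
  a ∎
  where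
  open ≡-Reasoning
  rev : reverse (l ++ a ∷ b ∷ r) ≡ reverse r ++ b ∷ a ∷ reverse l
  rev = begin
    reverse (l ++ a ∷ b ∷ r)                    ≡⟨ reverse-++ l (a ∷ b ∷ r) ⟩
    reverse ((a ∷ b ∷ []) ++ r) ++ reverse l    ≡⟨ cong (_++ reverse l) (reverse-++ (a ∷ b ∷ []) r) ⟩
    (reverse r ++ b ∷ a ∷ []) ++ reverse l      ≡⟨ ++-assoc (reverse r) (b ∷ a ∷ []) (reverse l) ⟩
    reverse r ++ b ∷ a ∷ reverse l              ∎
cyclicSuc-reverse {a = a} u a∈ | [] , [] , refl , _ = trans (cong (cyclicSuc [ a ]) fixed) fixed
  where
  fixed : cyclicSuc [ a ] a ≡ a
  fixed = cyclicSuc-eq {xs = [ a ]} (rotateAfter-split a [] [] λ ())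
cyclicSuc-reverse {a = a} u a∈ | b ∷ l , [] , refl , _ = begin
  cyclicSuc (reverse (b ∷ l ++ [ a ])) (cyclicSuc (b ∷ l ++ [ a ]) a)
    ≡⟨ cong₂ cyclicSuc rev (cyclicSuc-wrap l u) ⟩
  cyclicSuc (a ∷ reverse l ++ [ b ]) b
    ≡⟨ cyclicSuc-wrap (reverse l) (subst Unique rev (Unique-reverse u)) ⟩
  a ∎
  where
  open ≡-Reasoning
  rev : reverse (b ∷ l ++ [ a ]) ≡ a ∷ reverse l ++ [ b ]
  rev = trans (unfold-reverse b (l ++ [ a ])) (cong (_++ [ b ]) (reverse-++ l [ a ]))

-- The search made by `next`, as an iteration of `σ`: at least one step, then a stop at the first
-- point satisfying `p`, possibly `a` itself.
data Skip {A : Set} (σ : A → A) (p : A → Bool) (a : A) : A → Set where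
  here : p (σ a) ≡ true → Skip σ p a (σ a)
  skip : ∀ {c} → p (σ a) ≡ false → Skip σ p (σ a) c → Skip σ p a c

-- Here `bs` is still to be scanned and `cs` has been scanned; each step rotates one entry from `bs`
-- to the end of `cs`.
firstWith⇒Skip : ∀ {k} {xs : List (Fin k)} {p a c} bs cs → Unique xs → a ∈ xs →
                 rotateAfter xs a ≡ bs ++ cs → firstWith p bs ≡ just c → Skip (cyclicSuc xs) p a c
firstWith⇒Skip {xs = xs} {p} {a} (b ∷ bs) cs u a∈ eq first with p b in pb
firstWith⇒Skip {xs = xs} {p} {a} (b ∷ bs) cs u a∈ eq refl | true
  rewrite sym (cyclicSuc-eq {xs = xs} {a} eq) = here pb
... | false = skip (trans (cong p suc≡) pb)
    (firstWith⇒Skip bs (cs ++ [ b ]) u (cyclicSuc-∈ a∈)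
      (trans (cong (rotateAfter xs) suc≡) (trans (rotateAfter-step u a∈ eq) (++-assoc bs cs [ b ]))) first)
  where suc≡ = cyclicSuc-eq {xs = xs} {a} eq

next⇒Skip : ∀ {k} {xs : List (Fin k)} {p a c} → Unique xs → a ∈ xs →
            next xs a p ≡ just c → Skip (cyclicSuc xs) p a c
next⇒Skip {xs = xs} {a = a} u a∈ = firstWith⇒Skip (rotateAfter xs a) [] u a∈ (sym (++-identityʳ _))

firstWith-just : ∀ {k} (p : Fin k → Bool) {xs c} → c ∈ xs → p c ≡ true → ∃ λ d → firstWith p xs ≡ just d
firstWith-just p (here refl) pc rewrite pc = _ , refl
firstWith-just p {x ∷ _} (there c∈) pc with p x
... | true  = x , refl
... | false = firstWith-just p c∈ pc

next-just : ∀ {k} {xs : List (Fin k)} (p : Fin k → Bool) {a c} → a ∈ xs → c ∈ xs → p c ≡ true →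
            ∃ λ d → next xs a p ≡ just d
next-just p a∈ c∈ = firstWith-just p (∈-rotateAfter a∈ c∈)

next-first : ∀ {k} {xs : List (Fin k)} (p : Fin k → Bool) {a} → a ∈ xs → p (cyclicSuc xs a) ≡ true →
             next xs a p ≡ just (cyclicSuc xs a)
next-first p a∈ pc with rotateAfter-∷ a∈
... | bs , eq rewrite eq | pc = refl

Skip-sat : ∀ {A : Set} {σ : A → A} {p a c} → Skip σ p a c → p c ≡ true
Skip-sat (here pc)  = pc
Skip-sat (skip _ s) = Skip-sat s

Skip-closed : ∀ {A : Set} {σ : A → A} {p a c} (P : A → Set) → (∀ {a} → P a → P (σ a)) → P a → Skip σ p a c → P c
Skip-closed P Pσ Pa (here _)   = Pσ Pa
Skip-closed P Pσ Pa (skip _ s) = Skip-closed P Pσ (Pσ Pa) s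

-- A search for `c` itself reaches it by iterating `cyclicSuc`, and `P` is carried along.
cyclicSuc-transitive : ∀ {k} {xs : List (Fin k)} {a c} (P : Fin k → Set) → Unique xs → a ∈ xs → c ∈ xs →
                       (∀ {b} → b ∈ xs → P b → P (cyclicSuc xs b)) → P a → P c
cyclicSuc-transitive {xs = xs} {a} {c} P u a∈ c∈ closed Pa
  with next-just (λ x → does (x ≟ c)) a∈ c∈ (dec-true (c ≟ c) refl)
... | d , eq with next⇒Skip u a∈ eq
... | s with d ≟ c | Skip-sat s
... | yes refl | _ = proj₂ (Skip-closed (λ b → b ∈ xs × P b) (λ (b∈ , Pb) → cyclicSuc-∈ b∈ , closed b∈ Pb) (a∈ , Pa) s)

-- Darts, cuts and trees

-- A dart is an edge together with the endpoint from which it is seen.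
Dart : ℕ → ℕ → Set
Dart n m = Fin n × Fin m × Side

opposite : Side → Side
opposite fromV = fromE
opposite fromE = fromV

opposite-involutive : ∀ s → opposite (opposite s) ≡ s
opposite-involutive fromV = refl
opposite-involutive fromE = refl

_≟S_ : DecidableEquality Side
fromV ≟S fromV = yes refl
fromV ≟S fromE = no λ ()
fromE ≟S fromV = no λ ()
fromE ≟S fromE = yes refl

module _ {n m : ℕ} where

  flip : Dart n m → Dart n m
  flip (v , e , s) = v , e , opposite s

  node : Dart n m → Node n m
  node (v , e , fromV) = inj₁ v
  node (v , e , fromE) = inj₂ e

  edge : Dart n m → Fin n × Fin m
  edge (v , e , s) = v , e

  side : Dart n m → Side
  side (v , e , s) = s

  has : Graph n m → Dart n m → Bool
  has G (v , e , s) = G v e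

  _∖_ : Graph n m → Dart n m → Graph n m
  G ∖ (v , e , s) = del G v e

  flip-flip : ∀ d → flip (flip d) ≡ d
  flip-flip (v , e , s) = cong (λ s → v , e , s) (opposite-involutive s)

  _≟E_ : DecidableEquality (Fin n × Fin m)
  _≟E_ = ×-≡-dec _≟_ _≟_

  _≟D_ : DecidableEquality (Dart n m)
  _≟D_ = ×-≡-dec _≟_ (×-≡-dec _≟_ _≟S_)

  _≟N_ : DecidableEquality (Node n m)
  _≟N_ = ⊎-≡-dec _≟_ _≟_

  same-edge : ∀ {d g : Dart n m} → edge g ≡ edge d → g ≡ d ⊎ g ≡ flip d
  same-edge {_ , _ , fromV} {_ , _ , fromV} refl = inj₁ refl
  same-edge {_ , _ , fromV} {_ , _ , fromE} refl = inj₂ refl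
  same-edge {_ , _ , fromE} {_ , _ , fromV} refl = inj₂ refl
  same-edge {_ , _ , fromE} {_ , _ , fromE} refl = inj₁ refl

  node-edge : ∀ {d g : Dart n m} → node g ≡ node d → node (flip g) ≡ node (flip d) → g ≡ d
  node-edge {_ , _ , fromV} {_ , _ , fromV} refl refl = refl
  node-edge {_ , _ , fromE} {_ , _ , fromE} refl refl = refl

  node≢flip : ∀ d → node d ≢ node (flip d)
  node≢flip (v , e , fromV) ()
  node≢flip (v , e , fromE) ()

  Adj⇒Dart : ∀ {G x y} → Adj G x y → ∃ λ d → has G d ≡ true × node d ≡ x × node (flip d) ≡ y
  Adj⇒Dart {x = inj₁ v} {inj₂ e} p = (v , e , fromV) , p , refl , refl
  Adj⇒Dart {x = inj₂ e} {inj₁ v} p = (v , e , fromE) , p , refl , refl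

  Dart⇒Adj : ∀ {G} d → has G d ≡ true → Adj G (node d) (node (flip d))
  Dart⇒Adj (v , e , fromV) p = p
  Dart⇒Adj (v , e , fromE) p = p

  Adj-sym : ∀ {G : Graph n m} {x y} → Adj G x y → Adj G y x
  Adj-sym {x = inj₁ _} {inj₂ _} p = p
  Adj-sym {x = inj₂ _} {inj₁ _} p = p

  del-keeps : ∀ G d g → edge g ≢ edge d → has (G ∖ d) g ≡ has G g
  del-keeps G (v , e , _) (v′ , e′ , _) g≢d with v′ ≟ v | e′ ≟ e
  ... | yes refl | yes refl = contradiction refl g≢d
  ... | yes _    | no _     = refl
  ... | no _     | _        = refl

  del-removes : ∀ G d g → edge g ≡ edge d → has (G ∖ d) g ≡ false
  del-removes G (v , e , _) g refl rewrite dec-true (v ≟ v) refl | dec-true (e ≟ e) refl = refl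

  del-⊆ : ∀ G d g → has (G ∖ d) g ≡ true → has G g ≡ true × edge g ≢ edge d
  del-⊆ G d g p with edge g ≟E edge d
  ... | yes g≡d = contradiction (trans (sym p) (del-removes G d g g≡d)) λ ()
  ... | no g≢d  = trans (sym (del-keeps G d g g≢d)) p , g≢d

  -- A fundamental cut as a two-colouring. In a forest it need not be unique, so cuts survive the
  -- deletion of edges.
  record Cut (T : Graph n m) (d : Dart n m) (c : Node n m → Bool) : Set where
    constructor mkCut
    field
      separates : c (node d) ≢ c (node (flip d))
      respects  : ∀ g → has T g ≡ true → edge g ≢ edge d → c (node g) ≡ c (node (flip g))

  open Cut public

  Cut-flip : ∀ {T d c} → Cut T d c → Cut T (flip d) c
  Cut-flip {T} {d} {c} cut =
    mkCut (λ p → separates cut (sym (trans p (cong (λ g → c (node g)) (flip-flip d))))) (respects cut)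

  Cut-node : ∀ {T d c} → Cut T d c → ∀ {x} → c x ≢ c (node d) → c x ≡ c (node (flip d))
  Cut-node {T} {d} {c} (mkCut ends _) {x} x≢ with c x | c (node d) | c (node (flip d))
  ... | true  | true  | _     = contradiction refl x≢
  ... | true  | false | true  = refl
  ... | true  | false | false = contradiction refl ends
  ... | false | true  | true  = contradiction refl ends
  ... | false | true  | false = refl
  ... | false | false | _     = contradiction refl x≢

  -- A cut for every edge stands in for acyclicity, because the arguments about tours work with
  -- cuts. Conversions from and to `Acyclic` follow.
  IsTree : Graph n m → Set
  IsTree T = Connected T × (∀ d → has T d ≡ true → ∃ (Cut T d))

  module _ {G : Graph n m} where

    Star-sym : ∀ {x y} → Star (Adj G) x y → Star (Adj G) y x
    Star-sym ε = ε
    Star-sym (p ◅ ps) = Star-sym ps ◅◅ (Adj-sym p ◅ ε)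

    -- Cut a path at its first use of d.
    split-at : ∀ d {z x} → Star (Adj G) z x → x ≡ node d →
               Star (Adj (G ∖ d)) z (node d) ⊎ Star (Adj (G ∖ d)) z (node (flip d))
    split-at d ε refl = inj₁ ε
    split-at d {z} (p ◅ ps) x≡ with Adj⇒Dart {G = G} p
    ... | g , Gg , refl , refl with edge g ≟E edge d
    ... | yes g≡d with same-edge {d} {g} g≡d
    ... | inj₁ refl = inj₁ ε
    ... | inj₂ refl = inj₂ ε
    split-at d (p ◅ ps) x≡ | g , Gg , refl , refl | no g≢d with split-at d ps x≡
    ... | inj₁ qs = inj₁ (dart-step′ ◅ qs)
      where dart-step′ = Dart⇒Adj {G ∖ d} g (trans (del-keeps G d g g≢d) Gg)
    ... | inj₂ qs = inj₂ (dart-step′ ◅ qs)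
      where dart-step′ = Dart⇒Adj {G ∖ d} g (trans (del-keeps G d g g≢d) Gg)

    split : Connected G → ∀ d z → Star (Adj (G ∖ d)) z (node d) ⊎ Star (Adj (G ∖ d)) z (node (flip d))
    split conn d z = split-at d (conn z (node d)) refl

    Cut-path : ∀ {d c} → Cut G d c → ∀ {x y} → Star (Adj (G ∖ d)) x y → c x ≡ c y
    Cut-path cut ε = refl
    Cut-path {d} cut (p ◅ ps) with Adj⇒Dart {G = G ∖ d} p
    ... | g , Gg , refl , refl with del-⊆ G d g Gg
    ... | Gg′ , g≢d = trans (respects cut g Gg′ g≢d) (Cut-path cut ps)

    Cut-connected : Connected G → ∀ {d c} → Cut G d c → ∀ z → c z ≡ c (node d) → Star (Adj (G ∖ d)) z (node d)
    Cut-connected conn {d} cut z same with split conn d z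
    ... | inj₁ ps = ps
    ... | inj₂ ps = contradiction (trans (sym same) (Cut-path cut ps)) (separates cut)

    data Path (x : Node n m) : List (Node n m) → Node n m → Set where
      single : Path x [ x ] x
      cons   : ∀ {y ys z} → Adj G x y → x ∉ ys → Path y ys z → Path x (x ∷ ys) z

    Path-suffix : ∀ {w x ys z} → w ∈ ys → Path x ys z → ∃ λ ys′ → Path w ys′ z
    Path-suffix (here refl) single            = _ , single
    Path-suffix (here refl) p@(cons _ _ _)    = _ , p
    Path-suffix (there w∈)  (cons _ _ p)      = Path-suffix w∈ p

    Star⇒Path : ∀ {x z} → Star (Adj G) x z → ∃ λ ys → Path x ys z
    Star⇒Path ε = _ , single
    Star⇒Path {x} (a ◅ s) with Star⇒Path s
    ... | ys , p with member? _≟N_ x ys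
    ... | yes x∈ = Path-suffix x∈ p
    ... | no x∉  = _ , cons a x∉ p

    Path⇒Unique : ∀ {x ys z} → Path x ys z → Unique ys
    Path⇒Unique single        = [] ∷ []
    Path⇒Unique (cons _ x∉ p) = ¬Any⇒All¬ _ x∉ ∷ Path⇒Unique p

  Path⇒Chain : ∀ {G H : Graph n m} → (∀ {x y} → Adj G x y → Adj H x y) →
               ∀ {x ys z w} → Path {G} x ys z → Adj H z w → Chain H (ys ++ [ w ])
  Path⇒Chain G⊆H single a = a , tt
  Path⇒Chain G⊆H (cons b _ single) a = G⊆H b , a , tt
  Path⇒Chain G⊆H (cons b _ p@(cons _ _ _)) a = G⊆H b , Path⇒Chain G⊆H p a

  del-Adj : ∀ {G : Graph n m} d {x y} → Adj (G ∖ d) x y → Adj G x y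
  del-Adj {G} d a with Adj⇒Dart {G = G ∖ d} a
  ... | g , Gg , refl , refl = Dart⇒Adj g (proj₁ (del-⊆ G d g Gg))

  -- A simple path between the ends of `d` closes with `d` to a cycle. It has at least three nodes:
  -- the ends differ, and a path of two nodes would use the deleted edge.
  Acyclic⇒bridge : ∀ {T : Graph n m} → Acyclic T → ∀ d → has T d ≡ true →
                   ¬ Star (Adj (T ∖ d)) (node d) (node (flip d))
  Acyclic⇒bridge {T} acyclic d Td path with Star⇒Path path
  ... | ys , p = acyclic ys (cycle p refl refl)
    where
    cycle : ∀ {x ys z} → Path {T ∖ d} x ys z → x ≡ node d → z ≡ node (flip d) → IsCycle T ys
    cycle single refl x≡ = contradiction x≡ (node≢flip d)
    cycle (cons a _ single) refl refl with Adj⇒Dart {G = T ∖ d} a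
    ... | g , Tg , g≡ , g′≡ =
      contradiction (cong edge (node-edge {d} {g} g≡ g′≡)) (proj₂ (del-⊆ T d g Tg))
    cycle p@(cons _ _ (cons _ _ single)) refl refl =
      Path⇒Unique p , s≤s (s≤s (s≤s z≤n)) , Path⇒Chain (del-Adj d) p (Adj-sym (Dart⇒Adj d Td))
    cycle p@(cons _ _ (cons _ _ (cons _ _ _))) refl refl =
      Path⇒Unique p , s≤s (s≤s (s≤s z≤n)) , Path⇒Chain (del-Adj d) p (Adj-sym (Dart⇒Adj d Td))

  -- Colour a node by the end of `d` that `split` reaches from it without `d`. Another edge with
  -- ends of both colours would connect the ends of the bridge `d`.
  Acyclic⇒IsTree : ∀ {T : Graph n m} → Connected T → Acyclic T → IsTree T
  Acyclic⇒IsTree {T} conn acyclic = conn , λ d Td → colour d , mkCut (ends d Td) (rest d Td)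
    where
    colour : Dart n m → Node n m → Bool
    colour d z with split conn d z
    ... | inj₁ _ = true
    ... | inj₂ _ = false
    ends : ∀ d → has T d ≡ true → colour d (node d) ≢ colour d (node (flip d))
    ends d Td with split conn d (node d) | split conn d (node (flip d))
    ... | inj₁ _ | inj₂ _ = λ ()
    ... | inj₁ _ | inj₁ p = λ _ → Acyclic⇒bridge acyclic d Td (Star-sym p)
    ... | inj₂ p | _      = λ _ → Acyclic⇒bridge acyclic d Td p
    rest : ∀ d → has T d ≡ true → ∀ g → has T g ≡ true → edge g ≢ edge d →
           colour d (node g) ≡ colour d (node (flip g))
    rest d Td g Tg g≢d with split conn d (node g) | split conn d (node (flip g))
    ... | inj₁ _ | inj₁ _ = refl
    ... | inj₂ _ | inj₂ _ = refl
    ... | inj₁ p | inj₂ q = contradiction (Star-sym p ◅◅ (Dart⇒Adj g Tg′ ◅ q)) (Acyclic⇒bridge acyclic d Td)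
      where Tg′ = trans (del-keeps T d g g≢d) Tg
    ... | inj₂ p | inj₁ q =
      contradiction (Star-sym (Star-sym p ◅◅ (Dart⇒Adj g Tg′ ◅ q))) (Acyclic⇒bridge acyclic d Td)
      where Tg′ = trans (del-keeps T d g g≢d) Tg

  -- Using the edge of `d` would mean entering or leaving `node (flip d)`, which the chain avoids,
  -- so the colour is constant along it.
  Cut-Chain : ∀ {T : Graph n m} {d c x} → Cut T d c → x ≢ node (flip d) → ∀ a as → Chain T (a ∷ as ++ [ x ]) →
              node (flip d) ∉ a ∷ as → c a ≡ c x
  Cut-Chain {T} {d} {c} {x} cut x≢ a as chain y∉ = go a as chain y∉
    where
    step : ∀ {a b} → Adj T a b → a ≢ node (flip d) → b ≢ node (flip d) → c a ≡ c b
    step p a≢ b≢ with Adj⇒Dart {G = T} p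
    ... | g , Tg , refl , refl = respects cut g Tg λ g≡d → case-edge (same-edge {d} {g} g≡d)
      where
      case-edge : g ≡ d ⊎ g ≡ flip d → ⊥
      case-edge (inj₁ refl) = b≢ refl
      case-edge (inj₂ refl) = a≢ refl
    go : ∀ a as → Chain T (a ∷ as ++ [ x ]) → node (flip d) ∉ a ∷ as → c a ≡ c x
    go a [] (p , _) y∉ = step p (λ a≡ → y∉ (here (sym a≡))) x≢
    go a (b ∷ as) (p , chain) y∉ =
      trans (step p (λ a≡ → y∉ (here (sym a≡))) (λ b≡ → y∉ (there (here (sym b≡)))))
            (go b as chain (λ y∈ → y∉ (there y∈)))

  -- In a cycle starting with `x`, `a`, `b`, the edges after `xa` lead back to `x` without using
  -- `xa`, so the cut of `xa` would give both its ends one colour.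
  IsTree⇒Acyclic : ∀ {T : Graph n m} → IsTree T → Acyclic T
  IsTree⇒Acyclic {T} (_ , cuts) (x ∷ a ∷ []) (_ , s≤s (s≤s ()) , _)
  IsTree⇒Acyclic {T} (_ , cuts) (x ∷ a ∷ b ∷ as) ((x≢a ∷ x≢b ∷ _) ∷ a≢ ∷ _ , _ , xa , ab , chain)
    with Adj⇒Dart {G = T} xa | Adj⇒Dart {G = T} ab
  ... | d , Td , refl , refl | g , Tg , g≡ , g′≡ with cuts d Td
  ... | c , cut = separates cut (sym (begin
    c (node (flip d)) ≡⟨ cong c g≡ ⟨
    c (node g)        ≡⟨ respects cut g Tg (λ q → case-edge (same-edge {d} {g} q)) ⟩
    c (node (flip g)) ≡⟨ cong c g′≡ ⟩
    c b               ≡⟨ Cut-Chain cut x≢a b as chain (λ a∈ → All.lookup a≢ a∈ refl) ⟩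
    c (node d)        ∎))
    where
    open ≡-Reasoning
    case-edge : g ≡ d ⊎ g ≡ flip d → ⊥
    case-edge (inj₁ refl) = x≢a g≡
    case-edge (inj₂ refl) = x≢b (trans (cong node (sym (flip-flip d))) g′≡)

-- Tours

least : ∀ {P : ℕ → Set} → (∀ i → Dec (P i)) → ∀ k →
        (∃ λ t → t < k × P t × (∀ i → i < t → ¬ P i)) ⊎ (∀ i → i < k → ¬ P i)
least P? zero = inj₂ λ _ ()
least P? (suc k) with least P? k
... | inj₁ (t , t<k , Pt , below) = inj₁ (t , m≤n⇒m≤1+n t<k , Pt , below)
... | inj₂ none with P? k
... | yes Pk = inj₁ (k , n<1+n k , Pk , none)
... | no ¬Pk = inj₂ λ i i<1+k → λ Pi → case i (m≤n⇒m<n∨m≡n (≤-pred i<1+k)) Pi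
  where
  case : ∀ i → i < k ⊎ i ≡ k → ¬ _
  case i (inj₁ i<k)  = none i i<k
  case i (inj₂ refl) = ¬Pk

module _ {n m : ℕ} where

  rotate : (Fin n → List (Fin m)) → (Fin m → List (Fin n)) → Dart n m → Dart n m
  rotate ordV ordE (v , e , fromV) = v , cyclicSuc (ordV v) e , fromV
  rotate ordV ordE (v , e , fromE) = cyclicSuc (ordE e) v , e , fromE

  twist : Graph n m → Dart n m → Dart n m
  twist F d = if has F d then flip d else d

  twist-true : ∀ F d → has F d ≡ true → twist F d ≡ flip d
  twist-true F d p rewrite p = refl

  twist-false : ∀ F d → has F d ≡ false → twist F d ≡ d
  twist-false F d p rewrite p = refl

  twist-twist : ∀ F d → twist F (twist F d) ≡ d
  twist-twist F d with has F d in p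
  ... | true  rewrite p = flip-flip d
  ... | false rewrite p = refl

  IsRibbon-reverse : ∀ {inc : Graph n m} {ordV ordE} → IsRibbon inc ordV ordE → IsRibbon inc (revV ordV) (revE ordE)
  IsRibbon-reverse (ribV , ribE) =
    (λ v → Unique-reverse (proj₁ (ribV v)) , λ e → ∈-reverse (proj₂ (ribV v) e)) ,
    (λ e → Unique-reverse (proj₁ (ribE e)) , λ v → ∈-reverse (proj₂ (ribE e) v))
    where
    ∈-reverse : ∀ {A : Set} {x : A} {xs B} → x ∈ xs ⇔ B → x ∈ reverse xs ⇔ B
    ∈-reverse x∈⇔ = mk⇔ (λ x∈ → Equivalence.to x∈⇔ (reverse⁻ x∈)) (λ b → reverse⁺ (Equivalence.from x∈⇔ b))

module Tour {n m : ℕ} {inc : Graph n m} {ordV ordE} (ribbon : IsRibbon inc ordV ordE) where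

  uniqueV : ∀ v → Unique (ordV v)
  uniqueV v = proj₁ (proj₁ ribbon v)

  uniqueE : ∀ e → Unique (ordE e)
  uniqueE e = proj₁ (proj₂ ribbon e)

  inc⇒∈V : ∀ {v e} → inc v e ≡ true → e ∈ ordV v
  inc⇒∈V {v} {e} = Equivalence.from (proj₂ (proj₁ ribbon v) e)

  inc⇒∈E : ∀ {v e} → inc v e ≡ true → v ∈ ordE e
  inc⇒∈E {v} {e} = Equivalence.from (proj₂ (proj₂ ribbon e) v)

  ∈V⇒inc : ∀ {v e} → e ∈ ordV v → inc v e ≡ true
  ∈V⇒inc {v} {e} = Equivalence.to (proj₂ (proj₁ ribbon v) e)

  ∈E⇒inc : ∀ {v e} → v ∈ ordE e → inc v e ≡ true
  ∈E⇒inc {v} {e} = Equivalence.to (proj₂ (proj₂ ribbon e) v)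

  rot rot⁻ : Dart n m → Dart n m
  rot  = rotate ordV ordE
  rot⁻ = rotate (revV ordV) (revE ordE)

  rot-inc : ∀ d → has inc d ≡ true → has inc (rot d) ≡ true
  rot-inc (v , e , fromV) p = ∈V⇒inc (cyclicSuc-∈ (inc⇒∈V p))
  rot-inc (v , e , fromE) p = ∈E⇒inc (cyclicSuc-∈ (inc⇒∈E p))

  node-rot : ∀ d → node (rot d) ≡ node d
  node-rot (v , e , fromV) = refl
  node-rot (v , e , fromE) = refl

  rot⁻-rot : ∀ d → has inc d ≡ true → rot⁻ (rot d) ≡ d
  rot⁻-rot (v , e , fromV) p = cong (λ e → v , e , fromV) (cyclicSuc-reverse (uniqueV v) (inc⇒∈V p))
  rot⁻-rot (v , e , fromE) p = cong (λ v → v , e , fromE) (cyclicSuc-reverse (uniqueE e) (inc⇒∈E p))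

  rot-transitive : ∀ (P : Dart n m → Set) → (∀ d → has inc d ≡ true → P d → P (rot d)) →
                   ∀ d g → has inc d ≡ true → has inc g ≡ true → node d ≡ node g → P d → P g
  rot-transitive P closed (v , e , fromV) (v , e′ , fromV) p q refl =
    cyclicSuc-transitive (λ e → P (v , e , fromV)) (uniqueV v) (inc⇒∈V p) (inc⇒∈V q) λ b∈ → closed _ (∈V⇒inc b∈)
  rot-transitive P closed (v , e , fromE) (v′ , e , fromE) p q refl =
    cyclicSuc-transitive (λ v → P (v , e , fromE)) (uniqueE e) (inc⇒∈E p) (inc⇒∈E q) λ b∈ → closed _ (∈E⇒inc b∈)

  walk : Graph n m → Dart n m → Dart n m
  walk F d = rot (twist F d)

  tour : Graph n m → Dart n m → ℕ → Dart n m
  tour F d zero    = d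
  tour F d (suc k) = walk F (tour F d k)

  tour-+ : ∀ F d i j → tour F d (j + i) ≡ tour F (tour F d i) j
  tour-+ F d i zero    = refl
  tour-+ F d i (suc j) = cong (walk F) (tour-+ F d i j)

  twist-inc : ∀ F d → has inc d ≡ true → has inc (twist F d) ≡ true
  twist-inc F d p with has F d
  ... | true  = p
  ... | false = p

  tour-inc : ∀ F d → has inc d ≡ true → ∀ k → has inc (tour F d k) ≡ true
  tour-inc F d p zero    = p
  tour-inc F d p (suc k) = rot-inc (twist F (tour F d k)) (twist-inc F (tour F d k) (tour-inc F d p k))

  -- Both factors can be undone: `rot` by the reversed rotation, `twist` by itself.
  walk-injective : ∀ F d g → has inc d ≡ true → has inc g ≡ true → walk F d ≡ walk F g → d ≡ g
  walk-injective F d g p q eq = begin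
    d                              ≡⟨ twist-twist F d ⟨
    twist F (twist F d)            ≡⟨ cong (twist F) (rot⁻-rot _ (twist-inc F d p)) ⟨
    twist F (rot⁻ (walk F d))      ≡⟨ cong (λ h → twist F (rot⁻ h)) eq ⟩
    twist F (rot⁻ (walk F g))      ≡⟨ cong (twist F) (rot⁻-rot _ (twist-inc F g q)) ⟩
    twist F (twist F g)            ≡⟨ twist-twist F g ⟩
    g                              ∎
    where open ≡-Reasoning

  walk-true : ∀ F d → has F d ≡ true → walk F d ≡ rot (flip d)
  walk-true F d p = cong rot (twist-true F d p)

  walk-false : ∀ F d → has F d ≡ false → walk F d ≡ rot d
  walk-false F d p = cong rot (twist-false F d p)

  node-walk-true : ∀ F d → has F d ≡ true → node (walk F d) ≡ node (flip d)
  node-walk-true F d p = trans (cong node (walk-true F d p)) (node-rot (flip d))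

  node-walk-false : ∀ F d → has F d ≡ false → node (walk F d) ≡ node d
  node-walk-false F d p = trans (cong node (walk-false F d p)) (node-rot d)

  -- The colour of the current node changes only when the tour crosses the edge of `d`, and from the
  -- side of `node d` this happens only at the dart `d`.
  cross : ∀ {F d c d₀} → Cut F d c → ∀ i j → c (node (tour F d₀ i)) ≡ c (node d) →
          c (node (tour F d₀ (j + i))) ≢ c (node d) → ∃ λ l → i ≤ l × l < j + i × tour F d₀ l ≡ d
  cross cut i zero same differ = contradiction same differ
  cross {F} {d} {c} {d₀} cut i (suc j) same differ with tour F d₀ i ≟D d
  ... | yes eq = i , ≤-refl , s≤s (m≤n+m i j) , eq
  ... | no neq with cross cut (suc i) j (next-same (has F g) refl)
                    (subst (λ k → c (node (tour F d₀ k)) ≢ c (node d)) (sym (+-suc j i)) differ)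
    where
    g = tour F d₀ i
    next-same : ∀ b → has F g ≡ b → c (node (walk F g)) ≡ c (node d)
    next-same false p = trans (cong c (node-walk-false F g p)) same
    next-same true p with edge g ≟E edge d
    ... | no g≢d = trans (cong c (node-walk-true F g p)) (trans (sym (respects cut g p g≢d)) same)
    ... | yes g≡d with same-edge {d = d} {g} g≡d
    ... | inj₁ eq = contradiction eq neq
    ... | inj₂ eq = contradiction (trans (sym same) (cong (λ h → c (node h)) eq)) (separates cut)
  ... | l , i<l , l<j , eq = l , <⇒≤ i<l , subst (l <_) (+-suc j i) l<j , eq

  -- All conceivable darts are counted, in `inc` or not. The bound holds for every tree, so it later
  -- gives all codes a common length.
  dartBound : ℕ
  dartBound = n * (m * 2)

  code-dart : Dart n m → Fin dartBound
  code-dart (v , e , s) = combine v (combine e (code-side s))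
    where
    code-side : Side → Fin 2
    code-side fromV = zero
    code-side fromE = suc zero

  code-dart-injective : ∀ d g → code-dart d ≡ code-dart g → d ≡ g
  code-dart-injective (v , e , s) (v′ , e′ , s′) eq with combine-injective v _ v′ _ eq
  ... | refl , eq′ with combine-injective e _ e′ _ eq′
  code-dart-injective (v , e , fromV) (_ , _ , fromV) eq | refl , _ | refl , _ = refl
  code-dart-injective (v , e , fromE) (_ , _ , fromE) eq | refl , _ | refl , _ = refl

  record Period (F : Graph n m) (d : Dart n m) : Set where
    field
      period     : ℕ
      positive   : 0 < period
      bounded    : period ≤ dartBound
      returns    : tour F d period ≡ d
      injective  : ∀ {i j} → i < period → j < period → tour F d i ≡ tour F d j → i ≡ j

    reduce : ∀ k → ∃ λ i → i < period × i ≤ k × tour F d i ≡ tour F d k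
    reduce zero = 0 , positive , z≤n , refl
    reduce (suc k) with reduce k
    ... | i , i<p , i≤k , eq with m≤n⇒m<n∨m≡n i<p
    ... | inj₁ 1+i<p = suc i , 1+i<p , s≤s i≤k , cong (walk F) eq
    ... | inj₂ 1+i≡p = 0 , positive , z≤n , trans (sym returns) (trans (cong (tour F d) (sym 1+i≡p)) (cong (walk F) eq))

  module _ (F : Graph n m) {d : Dart n m} (inc-d : has inc d ≡ true) where

    -- Injectivity of `walk` peels off common steps, so a repetition always yields a return to `d`:
    -- the tour has no preperiod.
    tour-cancel : ∀ i j → tour F d i ≡ tour F d (j + i) → d ≡ tour F d j
    tour-cancel zero    j eq = trans eq (cong (tour F d) (+-identityʳ j))
    tour-cancel (suc i) j eq = tour-cancel i j
      (walk-injective F (tour F d i) (tour F d (j + i)) (tour-inc F d inc-d i) (tour-inc F d inc-d (j + i))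
        (trans eq (cong (tour F d) (+-suc j i))))

    tour-cancel-< : ∀ {i j} → i < j → tour F d i ≡ tour F d j → tour F d (j ∸ i) ≡ d
    tour-cancel-< {i} {j} i<j eq =
      sym (tour-cancel i (j ∸ i) (trans eq (cong (tour F d) (sym (m∸n+n≡m (<⇒≤ i<j))))))

    tour-period : Period F d
    tour-period with pigeonhole {dartBound} ≤-refl (λ i → code-dart (tour F d (toℕ i)))
    -- The search bound exceeds `toℕ j ∸ toℕ i` by one so that it includes the return given by the
    -- pigeonhole principle; time 0 is ruled out by asking for a positive time.
    ... | i , j , i<j , eq with least returning? (suc (toℕ j ∸ toℕ i))
      where
      returning? : ∀ k → Dec (0 < k × tour F d k ≡ d)
      returning? k = (0 <? k) ×-dec (tour F d k ≟D d)
    ... | inj₂ none = contradiction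
      (m<n⇒0<n∸m i<j , tour-cancel-< i<j (code-dart-injective _ _ eq)) (none (toℕ j ∸ toℕ i) ≤-refl)
    ... | inj₁ (N , N<1+j∸i , (0<N , returns) , below) = record
      { period    = N
      ; positive  = 0<N
      ; bounded   = ≤-trans (≤-pred N<1+j∸i) (≤-trans (m∸n≤m (toℕ j) (toℕ i)) (≤-pred (toℕ<n j)))
      ; returns   = returns
      ; injective = injective
      }
      where
      distinct : ∀ {i j} → j < N → i < j → tour F d i ≢ tour F d j
      distinct {i} {j} j<N i<j eq =
        below (j ∸ i) (≤-<-trans (m∸n≤m j i) j<N) (m<n⇒0<n∸m i<j , tour-cancel-< i<j eq)
      injective : ∀ {i j} → i < N → j < N → tour F d i ≡ tour F d j → i ≡ j
      injective {i} {j} i<N j<N eq with <-cmp i j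
      ... | tri< i<j _ _ = contradiction eq (distinct j<N i<j)
      ... | tri≈ _ i≡j _ = i≡j
      ... | tri> _ _ j<i = contradiction (sym eq) (distinct i<N j<i)

    module _ (F⊆inc : F ⊆G inc) (cuts : ∀ g → has F g ≡ true → ∃ (Cut F g)) where

      open Period tour-period

      Visited : Dart n m → Set
      Visited g = ∃ λ k → tour F d k ≡ g

      -- After crossing at `g` the tour is on the far side, yet one period later it is at `g` again.
      -- By `cross` it comes back through `flip g`, within the `period ∸ 1` steps left after the
      -- crossing.
      Visited-flip : ∀ {g} → has F g ≡ true → Visited g → Visited (flip g)
      Visited-flip {g} Fg (k , refl) with cuts g Fg
      ... | c , cut with cross {d = flip g} {c} {d} (Cut-flip {d = g} {c} cut) (suc k) (period ∸ 1)
                          (cong c (node-walk-true F g Fg)) back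
        where
        open ≡-Reasoning
        around : tour F d (period ∸ 1 + suc k) ≡ g
        around = begin
          tour F d (period ∸ 1 + suc k)       ≡⟨ cong (tour F d) (+-suc (period ∸ 1) k) ⟩
          tour F d (1 + (period ∸ 1) + k)     ≡⟨ cong (λ i → tour F d (i + k)) (trans (+-comm 1 _) (m∸n+n≡m positive)) ⟩
          tour F d (period + k)               ≡⟨ cong (tour F d) (+-comm period k) ⟩
          tour F d (k + period)               ≡⟨ tour-+ F d period k ⟩
          tour F (tour F d period) k          ≡⟨ cong (λ h → tour F h k) returns ⟩
          g                                   ∎
        back : c (node (tour F d (period ∸ 1 + suc k))) ≢ c (node (flip g))
        back eq = separates cut (trans (cong (λ h → c (node h)) (sym around)) eq)
      ... | l , _ , _ , eq = l , eq

      Visited-rot : ∀ g → has inc g ≡ true → Visited g → Visited (rot g)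
      Visited-rot g _ (k , refl) with has F (tour F d k) in p
      ... | false = suc k , walk-false F _ p
      ... | true with Visited-flip p (k , refl)
      ... | l , eq = suc l , trans (walk-true F _ (trans (cong (has F) eq) p))
                                          (cong rot (trans (cong flip eq) (flip-flip _)))

      -- Visited darts are closed under `rot` and, on edges of `F`, under `flip`, so they spread
      -- along a path of `F`. Asking only for a path to `z` admits a tree with one edge deleted.
      coverage : ∀ {z} → Star (Adj F) (node d) z → ∀ g → has inc g ≡ true → node g ≡ z →
                 ∃ λ k → k < period × tour F d k ≡ g
      coverage path g inc-g g≡ with go (0 , refl) inc-d refl path
        where
        go : ∀ {h x} → Visited h → has inc h ≡ true → node h ≡ x → Star (Adj F) x _ → Visited g
        go {h} vis inc-h refl ε = rot-transitive Visited Visited-rot h g inc-h inc-g (sym g≡) vis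
        go {h} vis inc-h refl (p ◅ ps) with Adj⇒Dart {G = F} p
        ... | (v , e , s) , Fk , k≡ , refl =
          go (Visited-flip {v , e , s} Fk
               (rot-transitive Visited Visited-rot h (v , e , s) inc-h (F⊆inc v e Fk) (sym k≡) vis))
             (F⊆inc v e Fk) refl ps
      ... | k , refl with reduce k
      ... | i , i<p , _ , eq = i , i<p , eq

-- Rooted trees and degrees

module _ {n m : ℕ} where

  -- The colouring depends on the undirected edge, so a dart and its flip are compared with the root
  -- by the same cut.
  record Rooted (T : Graph n m) (r : Node n m) : Set where
    field
      connected : Connected T
      colour    : Fin n × Fin m → Node n m → Bool
      cut       : ∀ d → has T d ≡ true → Cut T d (colour (edge d))

    -- d leads from its node towards the root.
    up : Dart n m → Bool
    up d = has T d ∧ does (colour (edge d) r ≟B colour (edge d) (node (flip d)))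

    up⇒has : ∀ d → up d ≡ true → has T d ≡ true
    up⇒has d p with has T d
    ... | true = refl

    up⇒colour : ∀ d → up d ≡ true → colour (edge d) r ≡ colour (edge d) (node (flip d))
    up⇒colour d p with has T d | colour (edge d) r ≟B colour (edge d) (node (flip d))
    ... | true | yes q = q

    colour⇒up : ∀ d → has T d ≡ true → colour (edge d) r ≡ colour (edge d) (node (flip d)) → up d ≡ true
    colour⇒up d p q rewrite p = dec-true (_ ≟B _) q

    -- If two edges led up from one node, the nodes on the root's side of both cuts could not be
    -- left along `T`, since the upper ends of both edges lie outside this set. But `node d` must be
    -- reached from the root.
    up-unique : ∀ d g → up d ≡ true → up g ≡ true → node d ≡ node g → d ≡ g
    up-unique d g ud ug same with edge d ≟E edge g
    ... | yes d≡g with same-edge {d = g} {d} d≡g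
    ... | inj₁ eq = eq
    ... | inj₂ refl = contradiction (sym same) (node≢flip g)
    up-unique d g ud ug same | no d≢g = contradiction (sym (proj₁ (spread (connected r (node d)) (refl , refl)))) d-off
      where
      cd = cut d (up⇒has d ud)
      cg = cut g (up⇒has g ug)
      κd = colour (edge d)
      κg = colour (edge g)
      d-off : κd r ≢ κd (node d)
      d-off eq = separates cd (trans (sym eq) (up⇒colour d ud))
      g-off : κg r ≢ κg (node g)
      g-off eq = separates cg (trans (sym eq) (up⇒colour g ug))
      Near : Node n m → Set
      Near z = κd z ≡ κd r × κg z ≡ κg r
      flip-d-off : ¬ Near (node (flip d))
      flip-d-off (_ , q) = g-off (trans (sym q) (trans (sym (respects cg d (up⇒has d ud) d≢g)) (cong κg same)))
      flip-g-off : ¬ Near (node (flip g))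
      flip-g-off (q , _) =
        d-off (trans (sym q) (trans (sym (respects cd g (up⇒has g ug) (λ p → d≢g (sym p)))) (cong κd (sym same))))
      spread : ∀ {x z} → Star (Adj T) x z → Near x → Near z
      spread ε near = near
      spread (p ◅ ps) near with Adj⇒Dart {G = T} p
      ... | h , Th , refl , refl with edge h ≟E edge d | edge h ≟E edge g
      ... | no h≢d | no h≢g = spread ps
        (trans (sym (respects cd h Th h≢d)) (proj₁ near) , trans (sym (respects cg h Th h≢g)) (proj₂ near))
      ... | yes h≡d | _ with same-edge {d = d} {h} h≡d
      ... | inj₁ refl = contradiction (sym (proj₁ near)) d-off
      ... | inj₂ refl = contradiction near flip-d-off
      spread (p ◅ ps) near | h , Th , refl , refl | no _ | yes h≡g with same-edge {d = g} {h} h≡g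
      ... | inj₁ refl = contradiction (sym (proj₂ near)) g-off
      ... | inj₂ refl = contradiction near flip-g-off

    -- The dart by which a path to the root leaves `x` for the last time leads up. So the search
    -- works back from the root, keeping that `z` has the root's colour in the cut of every tree
    -- dart at `x`.
    up-exists : ∀ x → x ≢ r → ∃ λ d → node d ≡ x × up d ≡ true
    up-exists x x≢r = start (connected x r)
      where
      search : ∀ {z} → Star (Adj T) z r →
               (∃ λ d → node d ≡ x × up d ≡ true) ⊎
               (z ≢ x × (∀ d → has T d ≡ true → node d ≡ x → colour (edge d) z ≡ colour (edge d) r))
      search ε = inj₂ ((λ r≡x → x≢r (sym r≡x)) , λ _ _ _ → refl)
      search {z} (p ◅ ps) with search ps
      ... | inj₁ found = inj₁ found
      ... | inj₂ (z′≢x , same) with Adj⇒Dart {G = T} p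
      ... | h , Th , refl , refl with node h ≟N x
      ... | yes h≡x = inj₁ (h , h≡x , colour⇒up h Th (sym (same h Th h≡x)))
      ... | no h≢x = inj₂ (h≢x , λ d Td d≡x →
        trans (respects (cut d Td) h Th (λ h≡d → touch d d≡x (same-edge {d = d} {h} h≡d))) (same d Td d≡x))
        where
        touch : ∀ d → node d ≡ x → ¬ (h ≡ d ⊎ h ≡ flip d)
        touch d d≡x (inj₁ refl) = h≢x d≡x
        touch d d≡x (inj₂ refl) = z′≢x (trans (cong node (flip-flip d)) d≡x)
      start : Star (Adj T) x r → ∃ λ d → node d ≡ x × up d ≡ true
      start ps with search ps
      ... | inj₁ found = found
      ... | inj₂ (x≢x , _) = contradiction refl x≢x

    up-root : ∀ d → node d ≡ r → up d ≢ true
    up-root d refl u = separates (cut d (up⇒has d u)) (up⇒colour d u)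

  root : ∀ {T : Graph n m} r → IsTree T → Rooted T r
  root {T} r (conn , cuts) = record { connected = conn ; colour = colour ; cut = cut }
    where
    choose : ∀ b → (b ≡ true → Node n m → Bool) → Node n m → Bool
    choose true  κ = κ refl
    choose false κ = λ _ → true
    choose-true : ∀ {b κ} (P : (Node n m → Bool) → Set) → (∀ p → P (κ p)) → b ≡ true → P (choose b κ)
    choose-true P Pκ refl = Pκ refl
    colour : Fin n × Fin m → Node n m → Bool
    colour (v , e) = choose (T v e) λ p → proj₁ (cuts (v , e , fromV) p)
    cutV : ∀ v e → T v e ≡ true → Cut T (v , e , fromV) (colour (v , e))
    cutV v e = choose-true (Cut T (v , e , fromV)) λ p → proj₂ (cuts (v , e , fromV) p)
    cut : ∀ d → has T d ≡ true → Cut T d (colour (edge d))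
    cut (v , e , fromV) p = cutV v e p
    cut (v , e , fromE) p = Cut-flip (cutV v e p)

toℕᵇ : Bool → ℕ
toℕᵇ b = if b then 1 else 0

countTrue-sum : ∀ {k} (p : Fin k → Bool) → countTrue p ≡ sum (toℕᵇ ∘ p)
countTrue-sum {zero}  p = refl
countTrue-sum {suc k} p = cong (toℕᵇ (p zero) +_) (countTrue-sum (p ∘ suc))

sum-mono : ∀ {k} {f g : Fin k → ℕ} → (∀ i → f i ≤ g i) → sum f ≤ sum g
sum-mono {zero}  f≤g = z≤n
sum-mono {suc k} f≤g = +-mono-≤ (f≤g zero) (sum-mono (f≤g ∘ suc))

term≤sum : ∀ {k} (f : Fin k → ℕ) i → f i ≤ sum f
term≤sum f zero    = m≤m+n (f zero) _
term≤sum f (suc i) = ≤-trans (term≤sum (f ∘ suc) i) (m≤n+m _ (f zero))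

sum-zero : ∀ {k} {f : Fin k → ℕ} → (∀ i → f i ≡ 0) → sum f ≡ 0
sum-zero {zero}  f≡0 = refl
sum-zero {suc k} f≡0 = cong₂ _+_ (f≡0 zero) (sum-zero (f≡0 ∘ suc))

sum-some : ∀ {k} (p : Fin k → Bool) {i} → p i ≡ true → 1 ≤ sum (toℕᵇ ∘ p)
sum-some p {i} pi = ≤-trans (≤-reflexive (sym (cong toℕᵇ pi))) (term≤sum (toℕᵇ ∘ p) i)

sum-none : ∀ {k} (p : Fin k → Bool) → (∀ i → p i ≢ true) → sum (toℕᵇ ∘ p) ≡ 0
sum-none p none = sum-zero λ i → cong toℕᵇ (¬-not (none i))

sum-unique : ∀ {k} (p : Fin k → Bool) → (∀ i j → p i ≡ true → p j ≡ true → i ≡ j) → sum (toℕᵇ ∘ p) ≤ 1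
sum-unique {zero} p unique = z≤n
sum-unique {suc k} p unique with p zero in p0
... | true  = ≤-reflexive (cong suc (sum-none (p ∘ suc) λ i pi → 0≢suc (unique zero (suc i) p0 pi)))
  where
  0≢suc : ∀ {i : Fin k} → zero ≢ suc i
  0≢suc ()
... | false = sum-unique (p ∘ suc) λ i j pi pj → suc-injective (unique (suc i) (suc j) pi pj)

sum-indicator : ∀ {k} (j : Fin k) → sum (λ i → toℕᵇ (does (i ≟ j))) ≡ 1
sum-indicator j = ≤-antisym
  (sum-unique (λ i → does (i ≟ j)) λ a b p q → trans (is a p) (sym (is b q)))
  (sum-some (λ i → does (i ≟ j)) {j} (dec-true (j ≟ j) refl))
  where
  is : ∀ i → does (i ≟ j) ≡ true → i ≡ j
  is i p with i ≟ j
  ... | yes q = q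

module _ {n m : ℕ} where

  private
    -- Exactly one end of a tree edge is on the root's side of its cut, so the edge leads up from
    -- exactly one end. The factor `a` will restrict the count to part of the emerald nodes.
    up-split : ∀ {U : Graph n m} {r} (R : Rooted U r) (a : Bool) v e → let open Rooted R in
               toℕᵇ (a ∧ U v e) ≡ toℕᵇ (a ∧ up (v , e , fromE)) + toℕᵇ (a ∧ up (v , e , fromV))
    up-split R false v e = refl
    up-split {U} {r} R true v e with U v e in Uve
    ... | false = refl
    ... | true with Rooted.colour R (v , e) r | Rooted.colour R (v , e) (inj₁ v) | Rooted.colour R (v , e) (inj₂ e)
                  | separates (Rooted.cut R (v , e , fromV) Uve)
    ... | true  | true  | true  | v≢e = contradiction refl v≢e
    ... | true  | true  | false | v≢e = refl
    ... | true  | false | true  | v≢e = refl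
    ... | true  | false | false | v≢e = contradiction refl v≢e
    ... | false | true  | true  | v≢e = contradiction refl v≢e
    ... | false | true  | false | v≢e = refl
    ... | false | false | true  | v≢e = refl
    ... | false | false | false | v≢e = contradiction refl v≢e

  -- Root both trees at e₀ and let A be the part of T - v₀e₀ containing e₀.  Each
  -- edge at an emerald node of A is the upward edge of exactly one node.  In T these
  -- nodes are those of A - e₀ and v₀; in U they lie in A - e₀.
  degree-obstruction :
    ∀ {T U : Graph n m} → IsTree T → IsTree U → (∀ e → degE T e ≡ degE U e) →
    ∀ {v₀ e₀ c} → T v₀ e₀ ≡ true → Cut T (v₀ , e₀ , fromV) c →
    ¬ (∀ v e → U v e ≡ true → c (inj₂ e) ≡ c (inj₂ e₀) → c (inj₁ v) ≡ c (inj₂ e₀))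
  degree-obstruction {T} {U} treeT treeU degrees {v₀} {e₀} {c} Tv₀e₀ cut₀ closed = <-irrefl refl (begin
    suc (sum inner + sum violet)          ≡⟨ +-suc (sum inner) (sum violet) ⟨
    sum inner + suc (sum violet)          ≤⟨ +-mono-≤ (sum-mono inner≤) extra ⟩
    Σ-E (up T-root) + Σ-V (up T-root) ≡⟨ total T-root ⟨
    sum (λ e → sum (λ v → toℕᵇ (A (inj₂ e) ∧ T v e))) ≡⟨ sum-cong-≗ same-degree ⟩
    sum (λ e → sum (λ v → toℕᵇ (A (inj₂ e) ∧ U v e))) ≡⟨ total U-root ⟩
    Σ-E (up U-root) + Σ-V (up U-root) ≤⟨ +-mono-≤ (sum-mono ≤inner) (sum-mono ≤violet) ⟩
    sum inner + sum violet                ∎)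
    where
    open ≤-Reasoning
    open Rooted using (up)
    T-root = root (inj₂ e₀) treeT
    U-root = root (inj₂ e₀) treeU
    A : Node n m → Bool
    A z = does (c z ≟B c (inj₂ e₀))
    A⇒ : ∀ {z} → A z ≡ true → c z ≡ c (inj₂ e₀)
    A⇒ {z} p with c z ≟B c (inj₂ e₀)
    ... | yes q = q
    ⇒A : ∀ {z} → c z ≡ c (inj₂ e₀) → A z ≡ true
    ⇒A = dec-true (_ ≟B _)
    inner : Fin m → ℕ
    inner e = toℕᵇ (A (inj₂ e) ∧ not (does (e ≟ e₀)))
    violet : Fin n → ℕ
    violet v = toℕᵇ (A (inj₁ v))
    row : (Dart n m → Bool) → Fin m → ℕ
    row u e = sum (λ v → toℕᵇ (A (inj₂ e) ∧ u (v , e , fromE)))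
    column : (Dart n m → Bool) → Fin n → ℕ
    column u v = sum (λ e → toℕᵇ (A (inj₂ e) ∧ u (v , e , fromV)))
    Σ-E Σ-V : (Dart n m → Bool) → ℕ
    Σ-E u = sum (row u)
    Σ-V u = sum (column u)
    total : ∀ {W} (R : Rooted W (inj₂ e₀)) →
            sum (λ e → sum (λ v → toℕᵇ (A (inj₂ e) ∧ W v e))) ≡ Σ-E (up R) + Σ-V (up R)
    total {W} R = begin-equality
      sum (λ e → sum (λ v → toℕᵇ (A (inj₂ e) ∧ W v e)))
        ≡⟨ sum-cong-≗ (λ e → trans (sum-cong-≗ (λ v → up-split R (A (inj₂ e)) v e)) (∑-distrib-+ {n} _ _)) ⟩
      sum (λ e → row (up R) e + sum (λ v → toℕᵇ (A (inj₂ e) ∧ up R (v , e , fromV))))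
        ≡⟨ ∑-distrib-+ (row (up R)) _ ⟩
      sum (row (up R)) + sum (λ e → sum (λ v → toℕᵇ (A (inj₂ e) ∧ up R (v , e , fromV))))
        ≡⟨ cong (sum (row (up R)) +_) (∑-comm {m} {n} _) ⟩
      Σ-E (up R) + Σ-V (up R) ∎
    same-degree : ∀ e → sum (λ v → toℕᵇ (A (inj₂ e) ∧ T v e)) ≡ sum (λ v → toℕᵇ (A (inj₂ e) ∧ U v e))
    same-degree e with A (inj₂ e)
    ... | false = refl
    ... | true  = trans (sym (countTrue-sum (λ v → T v e))) (trans (degrees e) (countTrue-sum (λ v → U v e)))
    T-crossing : ∀ d → has T d ≡ true → edge d ≢ (v₀ , e₀) → c (node d) ≡ c (node (flip d))
    T-crossing = respects cut₀
    inner≤ : ∀ e → inner e ≤ row (up T-root) e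
    inner≤ e with A (inj₂ e) | e ≟ e₀
    ... | false | _     = z≤n
    ... | true  | yes _ = z≤n
    ... | true  | no e≢e₀ with Rooted.up-exists T-root (inj₂ e) (λ { refl → e≢e₀ refl })
    ... | (v , _ , fromE) , refl , u = sum-some (λ v → up T-root (v , e , fromE)) u
    extra : suc (sum violet) ≤ Σ-V (up T-root)
    extra = begin
      suc (sum violet)                               ≡⟨ +-comm 1 (sum violet) ⟩
      sum violet + 1                                 ≡⟨ cong (sum violet +_) (sum-indicator v₀) ⟨
      sum violet + sum (λ v → toℕᵇ (does (v ≟ v₀)))  ≡⟨ ∑-distrib-+ violet _ ⟨
      sum (λ v → violet v + toℕᵇ (does (v ≟ v₀)))    ≤⟨ sum-mono column≥ ⟩
      Σ-V (up T-root) ∎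
      where
      v₀-off : A (inj₁ v₀) ≡ false
      v₀-off = dec-false (_ ≟B _) (separates cut₀)
      at-v₀ : up T-root (v₀ , e₀ , fromV) ≡ true
      at-v₀ = Rooted.colour⇒up T-root (v₀ , e₀ , fromV) Tv₀e₀ refl
      column≥ : ∀ v → violet v + toℕᵇ (does (v ≟ v₀)) ≤ column (up T-root) v
      column≥ v with v ≟ v₀
      column≥ v | yes refl rewrite v₀-off =
        sum-some (λ e → A (inj₂ e) ∧ up T-root (v₀ , e , fromV)) {e₀} (cong₂ _∧_ (⇒A {inj₂ e₀} refl) at-v₀)
      column≥ v | no v≢v₀ with A (inj₁ v) in Av
      ... | false = z≤n
      ... | true with Rooted.up-exists T-root (inj₁ v) (λ ())
      ... | (_ , e , fromV) , refl , u =
        sum-some (λ e → A (inj₂ e) ∧ up T-root (v , e , fromV)) {e}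
          (cong₂ _∧_ (⇒A (trans (sym same-side) (A⇒ Av))) u)
        where
        same-side = T-crossing (v , e , fromV) (Rooted.up⇒has T-root (v , e , fromV) u) λ { refl → v≢v₀ refl }
    ≤inner : ∀ e → row (up U-root) e ≤ inner e
    ≤inner e with A (inj₂ e) | e ≟ e₀
    ... | false | _ = ≤-reflexive (sum-zero {n} λ _ → refl)
    ... | true  | yes refl =
      ≤-reflexive (sum-none (λ v → up U-root (v , e , fromE)) λ v → Rooted.up-root U-root (v , e , fromE) refl)
    ... | true  | no _ = sum-unique (λ v → up U-root (v , e , fromE)) λ v v′ p q →
      cong proj₁ (Rooted.up-unique U-root (v , e , fromE) (v′ , e , fromE) p q refl)
    ≤violet : ∀ v → column (up U-root) v ≤ violet v
    ≤violet v with A (inj₁ v) in Av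
    ... | true = sum-unique (λ e → A (inj₂ e) ∧ up U-root (v , e , fromV)) λ e e′ p q →
      cong (λ d → proj₁ (proj₂ d))
        (Rooted.up-unique U-root (v , e , fromV) (v , e′ , fromV)
          (∧-conicalʳ (A (inj₂ e)) _ p) (∧-conicalʳ (A (inj₂ e′)) _ q) refl)
    -- By `closed`, no edge of `U` joins a violet node outside `A` to an emerald node of `A`.
    ... | false = ≤-reflexive (sum-none (λ e → A (inj₂ e) ∧ up U-root (v , e , fromV)) off)
      where
      off : ∀ e → A (inj₂ e) ∧ up U-root (v , e , fromV) ≢ true
      off e p = contradiction (trans (sym Av) (⇒A (closed v e (Rooted.up⇒has U-root (v , e , fromV) u) (A⇒ Ae)))) λ ()
        where
        Ae = ∧-conicalˡ (A (inj₂ e)) _ p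
        u  = ∧-conicalʳ (A (inj₂ e)) _ p

-- Exchanges and the existence of a violet-first tree

xor-≢ : ∀ {a b x y} → a ≢ b → x ≡ y → a xor x ≢ b xor y
xor-≢ {true}  {true}  a≢b _ = contradiction refl a≢b
xor-≢ {false} {false} a≢b _ = contradiction refl a≢b
xor-≢ {true}  {false} {true}  a≢b refl = λ ()
xor-≢ {true}  {false} {false} a≢b refl = λ ()
xor-≢ {false} {true}  {true}  a≢b refl = λ ()
xor-≢ {false} {true}  {false} a≢b refl = λ ()

xor-≡ : ∀ {a b x y} → a ≢ b → x ≢ y → a xor x ≡ b xor y
xor-≡ {true}  {true}  a≢b _ = contradiction refl a≢b
xor-≡ {false} {false} a≢b _ = contradiction refl a≢b
xor-≡ {x = true}  {true}  _ x≢y = contradiction refl x≢y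
xor-≡ {x = false} {false} _ x≢y = contradiction refl x≢y
xor-≡ {true}  {false} {true}  {false} _ _ = refl
xor-≡ {true}  {false} {false} {true}  _ _ = refl
xor-≡ {false} {true}  {true}  {false} _ _ = refl
xor-≡ {false} {true}  {false} {true}  _ _ = refl

countTrue-cong : ∀ {k} {p q : Fin k → Bool} → (∀ i → p i ≡ q i) → countTrue p ≡ countTrue q
countTrue-cong {p = p} {q} eq =
  trans (countTrue-sum p) (trans (sum-cong-≗ (λ i → cong toℕᵇ (eq i))) (sym (countTrue-sum q)))

module _ {n m : ℕ} where

  exchange : Graph n m → Fin n → Fin n → Fin m → Graph n m
  exchange T w′ w e v d = if does (v ≟ w) ∧ does (d ≟ e) then true else del T w′ e v d

  -- By `w~w′` the new edge `we` crosses the cut of the deleted edge `w′e`.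
  module Exchange {T : Graph n m} {w′ w e c} (tree : IsTree T) (T-w′e : T w′ e ≡ true) (T-we : T w e ≡ false)
                  (cut₀ : Cut T (w′ , e , fromV) c) (w~w′ : c (inj₁ w) ≡ c (inj₁ w′)) where

    T′ = exchange T w′ w e
    d₀ d₀′ : Dart n m
    d₀  = w , e , fromV
    d₀′ = w′ , e , fromV

    edges-differ : edge d₀ ≢ edge d₀′
    edges-differ refl = contradiction (trans (sym T-we) T-w′e) λ ()

    new : ∀ g → edge g ≡ edge d₀ → has T′ g ≡ true
    new _ refl rewrite dec-true (w ≟ w) refl | dec-true (e ≟ e) refl = refl

    not-new : ∀ g → edge g ≢ edge d₀ → has T′ g ≡ has (T ∖ d₀′) g
    not-new (v , d , _) g≢d with v ≟ w | d ≟ e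
    ... | yes refl | yes refl = contradiction refl g≢d
    ... | yes _    | no _     = refl
    ... | no _     | _        = refl

    old : ∀ g → edge g ≡ edge d₀′ → has T′ g ≡ false
    old g g≡ = trans (not-new g λ g≡′ → edges-differ (trans (sym g≡′) g≡)) (del-removes T d₀′ g g≡)

    kept : ∀ g → edge g ≢ edge d₀ → edge g ≢ edge d₀′ → has T′ g ≡ has T g
    kept g g≢ g≢′ = trans (not-new g g≢) (del-keeps T d₀′ g g≢′)

    kept⁻ : ∀ g → has T′ g ≡ true → edge g ≢ edge d₀ → has T g ≡ true × edge g ≢ edge d₀′
    kept⁻ g T′g g≢ = del-⊆ T d₀′ g (trans (sym (not-new g g≢)) T′g)

    kept⁺ : ∀ g → has T g ≡ true → edge g ≢ edge d₀′ → has T′ g ≡ true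
    kept⁺ g Tg g≢′ with edge g ≟E edge d₀
    ... | yes g≡ = new g g≡
    ... | no g≢  = trans (kept g g≢ g≢′) Tg

    detour : Star (Adj T′) (node d₀′) (node (flip d₀′))
    detour = Star-sym (gmap (λ x → x) lift (Cut-connected (proj₁ tree) cut₀ (node d₀) w~w′)) ◅◅ (new d₀ refl ◅ ε)
      where
      lift : ∀ {x y} → Adj (T ∖ d₀′) x y → Adj T′ x y
      lift p with Adj⇒Dart {G = T ∖ d₀′} p
      ... | g , Tg , refl , refl with del-⊆ T d₀′ g Tg
      ... | Tg′ , g≢′ = Dart⇒Adj g (kept⁺ g Tg′ g≢′)

    connected : Connected T′
    connected x y = go (proj₁ tree x y)
      where
      go : ∀ {x y} → Star (Adj T) x y → Star (Adj T′) x y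
      go ε = ε
      go (p ◅ ps) with Adj⇒Dart {G = T} p
      ... | g , Tg , refl , refl with edge g ≟E edge d₀′
      ... | no g≢ = Dart⇒Adj g (kept⁺ g Tg g≢) ◅ go ps
      ... | yes g≡ with same-edge {d = d₀′} {g} g≡
      ... | inj₁ refl = detour ◅◅ go ps
      ... | inj₂ refl = Star-sym detour ◅◅ go ps

    cut-new : Cut T′ d₀ c
    cut-new = mkCut (λ p → separates cut₀ (trans (sym w~w′) p)) λ g T′g g≢ →
      let Tg , g≢′ = kept⁻ g T′g g≢ in respects cut₀ g Tg g≢′

    same-ends : ∀ (κ : Node n m → Bool) g → edge g ≡ edge d₀ → κ (node d₀) ≡ κ (node (flip d₀)) →
                κ (node g) ≡ κ (node (flip g))
    same-ends κ g g≡ eq with same-edge {d = d₀} {g} g≡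
    ... | inj₁ refl = eq
    ... | inj₂ refl = sym eq

    -- The new edge inherits `c`. The cut `κ` of an old edge remains valid unless `we` crosses it;
    -- in that case its sum modulo 2 with `c` is a cut that `we` does not cross.
    cuts : ∀ d → has T′ d ≡ true → ∃ (Cut T′ d)
    cuts d T′d with edge d ≟E edge d₀
    cuts d T′d | yes d≡ with same-edge {d = d₀} {d} d≡
    ... | inj₁ refl = c , cut-new
    ... | inj₂ refl = c , Cut-flip cut-new
    cuts d T′d | no d≢ with kept⁻ d T′d d≢
    ... | Td , d≢′ with proj₂ tree d Td
    ... | κ , cutκ with κ (node d₀) ≟B κ (node (flip d₀))
    ... | yes same = κ , mkCut (separates cutκ) rest
      where
      rest : ∀ g → has T′ g ≡ true → edge g ≢ edge d → κ (node g) ≡ κ (node (flip g))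
      rest g T′g g≢d with edge g ≟E edge d₀
      ... | yes g≡ = same-ends κ g g≡ same
      ... | no g≢  = respects cutκ g (proj₁ (kept⁻ g T′g g≢)) g≢d
    ... | no differ = χ , mkCut (xor-≢ (separates cutκ) (respects cut₀ d Td d≢′)) rest
      where
      χ : Node n m → Bool
      χ z = κ z xor c z
      rest : ∀ g → has T′ g ≡ true → edge g ≢ edge d → χ (node g) ≡ χ (node (flip g))
      rest g T′g g≢d with edge g ≟E edge d₀
      ... | yes g≡ = same-ends χ g g≡ (xor-≡ differ (separates cut-new))
      ... | no g≢ with kept⁻ g T′g g≢
      ... | Tg , g≢′ = cong₂ _xor_ (respects cutκ g Tg g≢d) (respects cut₀ g Tg g≢′)

    isTree : IsTree T′
    isTree = connected , cuts

    degrees : ∀ d → degE T′ d ≡ degE T d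
    degrees d = by-cases (d ≟ e)
      where
      by-cases : Dec (d ≡ e) → degE T′ d ≡ degE T d
      by-cases (no d≢e) = countTrue-cong λ v → kept (v , d , fromV) (λ { refl → d≢e refl }) (λ { refl → d≢e refl })
      -- Adding the indicators of `w′` and `w` balances the loss and the gain at `e` without
      -- subtraction.
      by-cases (yes refl) = +-cancelʳ-≡ 1 (degE T′ e) (degE T e) (begin
        degE T′ e + 1
          ≡⟨ cong₂ _+_ (countTrue-sum (λ v → T′ v e)) (sym (sum-indicator w′)) ⟩
        sum (λ v → toℕᵇ (T′ v e)) + sum (λ v → toℕᵇ (does (v ≟ w′)))
          ≡⟨ ∑-distrib-+ (λ v → toℕᵇ (T′ v e)) (λ v → toℕᵇ (does (v ≟ w′))) ⟨
        sum (λ v → toℕᵇ (T′ v e) + toℕᵇ (does (v ≟ w′)))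
          ≡⟨ sum-cong-≗ pointwise ⟩
        sum (λ v → toℕᵇ (T v e) + toℕᵇ (does (v ≟ w)))
          ≡⟨ ∑-distrib-+ (λ v → toℕᵇ (T v e)) (λ v → toℕᵇ (does (v ≟ w))) ⟩
        sum (λ v → toℕᵇ (T v e)) + sum (λ v → toℕᵇ (does (v ≟ w)))
          ≡⟨ cong₂ _+_ (sym (countTrue-sum (λ v → T v e))) (sum-indicator w) ⟩
        degE T e + 1 ∎)
        where
        open ≡-Reasoning
        pointwise : ∀ v → toℕᵇ (T′ v e) + toℕᵇ (does (v ≟ w′)) ≡ toℕᵇ (T v e) + toℕᵇ (does (v ≟ w))
        pointwise v = compare (v ≟ w) (v ≟ w′)
          where
          compare : (p : Dec (v ≡ w)) (q : Dec (v ≡ w′)) →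
                     toℕᵇ (T′ v e) + toℕᵇ (does q) ≡ toℕᵇ (T v e) + toℕᵇ (does p)
          compare (yes refl) (yes refl) = contradiction refl edges-differ
          compare (yes refl) (no _) rewrite new d₀ refl | T-we = refl
          compare (no _) (yes refl) rewrite old d₀′ refl | T-w′e = refl
          compare (no v≢w) (no v≢w′) =
            cong (λ b → toℕᵇ b + 0) (kept (v , e , fromV) (λ { refl → v≢w refl }) (λ { refl → v≢w′ refl }))

-- For the tour of a spanning tree this has content only during the first turn, after which every
-- dart has been seen.
FirstSeenFrom : ∀ {n m} → Side → Graph n m → (ℕ → Dart n m) → Set
FirstSeenFrom s T path =
  ∀ k → has T (path k) ≡ false → side (path k) ≡ opposite s → ∃ λ j → j < k × path j ≡ flip (path k)

module JaegerTree {n m : ℕ} {inc : Graph n m} {ordV ordE} (ribbon : IsRibbon inc ordV ordE) where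

  open Tour ribbon

  restrict : ∀ {T : Graph n m} {h d c} → Cut T d c → Cut (T ∖ h) d c
  restrict {T} {h} cut = mkCut (separates cut) λ g Tg → respects cut g (proj₁ (del-⊆ T h g Tg))

  -- Between traversing g and returning to its node, the tour of T is the full orbit of
  -- the tour of T - g on the far side of g.
  subtour : ∀ {T : Graph n m} {d c} → T ⊆G inc → IsTree T → ∀ g → has T g ≡ true → Cut T g c →
            ∀ {t k} → tour T d t ≡ g → t < k → c (node (tour T d k)) ≡ c (node g) →
            ∀ h → has inc h ≡ true → h ≢ flip g → c (node h) ≡ c (node (flip g)) →
            ∃ λ l → l < k × tour T d l ≡ h
  subtour {T} {d} {c} T⊆inc tree g Tg cut {t} {k} at-t t<k back h inc-h h≢ far
    with coverage F {flip g} inc-g F⊆inc F-cuts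
           (Star-sym (Cut-connected (proj₁ tree) (Cut-flip cut) (node h) far)) h inc-h refl
    where
    F = T ∖ g
    inc-g : has inc (flip g) ≡ true
    inc-g = T⊆inc _ _ Tg
    F⊆inc : F ⊆G inc
    F⊆inc v e p = T⊆inc v e (proj₁ (del-⊆ T g (v , e , fromV) p))
    F-cuts : ∀ a → has F a ≡ true → ∃ (Cut F a)
    F-cuts a Fa with proj₂ tree a (proj₁ (del-⊆ T g a Fa))
    ... | κ , cutκ = κ , restrict {h = g} cutκ
  -- The smaller tour starts at `flip g`, a dart that the tour of `T` does not stop at when it
  -- crosses `g`; hence the exclusion of `flip g`.
  ... | zero , _ , eq = contradiction (sym eq) h≢
  ... | suc j , 1+j<p , eq = suc j + t , before , trans (agree j (<⇒≤ 1+j<p)) eq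
    where
    F = T ∖ g
    inc-g : has inc (flip g) ≡ true
    inc-g = T⊆inc _ _ Tg
    open Period (tour-period F {flip g} inc-g)
    stay : ∀ i → c (node (tour F (flip g) i)) ≡ c (node (flip g))
    stay zero = refl
    stay (suc i) = trans (move (has F a) refl) (stay i)
      where
      a = tour F (flip g) i
      move : ∀ b → has F a ≡ b → c (node (walk F a)) ≡ c (node a)
      move false p = cong c (node-walk-false F a p)
      move true p with del-⊆ T g a p
      ... | Ta , a≢g = trans (cong c (node-walk-true F a p)) (sym (respects cut a Ta a≢g))
    -- From time 1 on the tours coincide: crossing `g` in `T` and passing the deleted edge at
    -- `flip g` in `F` both give `rot (flip g)`.
    agree : ∀ i → suc i ≤ period → tour T d (suc i + t) ≡ tour F (flip g) (suc i)
    agree zero _ = begin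
      walk T (tour T d t) ≡⟨ cong (walk T) at-t ⟩
      walk T g            ≡⟨ walk-true T g Tg ⟩
      rot (flip g)        ≡⟨ walk-false F (flip g) (del-removes T g (flip g) refl) ⟨
      walk F (flip g)     ∎
      where open ≡-Reasoning
    agree (suc i) 1+i<p = trans (cong (walk T) (agree i (<⇒≤ 1+i<p)))
      (cong (λ b → rot (if b then flip a else a)) (sym (del-keeps T g a λ a≡g → at-g (same-edge {d = g} {a} a≡g))))
      where
      a = tour F (flip g) (suc i)
      at-g : ¬ (a ≡ g ⊎ a ≡ flip g)
      at-g (inj₁ eq) = separates cut (trans (cong (λ z → c (node z)) (sym eq)) (stay (suc i)))
      at-g (inj₂ eq) with injective 1+i<p positive eq
      ... | ()
    -- Otherwise time `k` would fall into the common stretch, which stays on the far side.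
    before : suc j + t < k
    before with suc j + t <? k
    ... | yes lt = lt
    ... | no ≮k = contradiction (trans (sym back) (subst (λ i → c (node (tour T d i)) ≡ c (node (flip g)))
        (trans (+-comm _ t) (m+[n∸m]≡n (<⇒≤ t<k))) (inside (k ∸ t) (m<n⇒0<n∸m t<k) k∸t≤))) (separates cut)
      where
      k∸t≤ : k ∸ t ≤ suc j
      k∸t≤ = subst (k ∸ t ≤_) (m+n∸n≡m (suc j) t) (∸-monoˡ-≤ t (≮⇒≥ ≮k))
      inside : ∀ i → 0 < i → i ≤ suc j → c (node (tour T d (i + t))) ≡ c (node (flip g))
      inside (suc i) _ i≤j = trans (cong (λ z → c (node z)) (agree i (≤-trans i≤j (<⇒≤ 1+j<p)))) (stay (suc i))

  -- The bits make non-tree edges good at violet and tree edges good at emerald nodes.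
  bit : Graph n m → Dart n m → Bool
  bit F (v , e , fromV) = not (F v e)
  bit F (v , e , fromE) = F v e

  -- The first `K` bits as a binary number, most significant first, so that `<` is the lexicographic
  -- order.
  code : Graph n m → Dart n m → ℕ → ℕ
  code F d zero    = 0
  code F d (suc K) = toℕᵇ (bit F d) * 2 ^ K + code F (walk F d) K

  bit-cong : ∀ F F′ d → has F d ≡ has F′ d → bit F d ≡ bit F′ d
  bit-cong F F′ (v , e , fromV) eq = cong not eq
  bit-cong F F′ (v , e , fromE) eq = eq

  code-bound : ∀ F d K → code F d K < 2 ^ K
  code-bound F d zero = s≤s z≤n
  code-bound F d (suc K) with bit F d
  ... | true  = +-mono-≤-< (≤-reflexive (+-identityʳ (2 ^ K))) (<-≤-trans (code-bound F _ K) (m≤m+n (2 ^ K) 0))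
  ... | false = <-≤-trans (code-bound F _ K) (m≤m+n (2 ^ K) _)

  tour-step : ∀ F d i → tour F (walk F d) i ≡ tour F d (suc i)
  tour-step F d zero    = refl
  tour-step F d (suc i) = cong (walk F) (tour-step F d i)

  -- Both graphs treat the earlier darts alike, so the tours stay together until time `t`; the bit
  -- gained there outweighs all later ones by `code-bound`.
  code-improves : ∀ F F′ d t {K} → t < K → (∀ i → i < t → has F (tour F d i) ≡ has F′ (tour F d i)) →
                  bit F (tour F d t) ≡ false → bit F′ (tour F d t) ≡ true → code F d K < code F′ d K
  code-improves F F′ d zero {suc K} _ _ bad good rewrite bad | good =
    <-≤-trans (code-bound F _ K) (≤-trans (m≤m+n (2 ^ K) 0) (m≤m+n (2 ^ K + 0) _))
  code-improves F F′ d (suc t) {suc K} (s≤s t<K) same bad good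
    rewrite sym (bit-cong F F′ d (same 0 z<s)) | sym (cong (λ b → rot (if b then flip d else d)) (same 0 z<s)) =
    +-monoʳ-< (toℕᵇ (bit F d) * 2 ^ K) (code-improves F F′ (walk F d) t t<K
      (λ i i<t → subst (λ g → has F g ≡ has F′ g) (sym (tour-step F d i)) (same (suc i) (s<s i<t)))
      (trans (cong (bit F) (tour-step F d t)) bad) (trans (cong (bit F′) (tour-step F d t)) good))

  Violation : Graph n m → Dart n m → ℕ → Set
  Violation T d k = has T (tour T d k) ≡ false × side (tour T d k) ≡ fromE ×
                    ¬ (∃ λ j → j < k × tour T d j ≡ flip (tour T d k))

  violation? : ∀ T d k → Dec (Violation T d k)
  violation? T d k = (_ ≟B _) ×-dec (_ ≟S _) ×-dec ¬? (anyUpTo? (λ j → tour T d j ≟D _) k)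

  SameDegrees : Graph n m → Graph n m → Set
  SameDegrees T U = ∀ e → degE T e ≡ degE U e

  -- The edge given up is the one at `e` towards `w`, which puts `w` and `w′` on the same side of
  -- its cut. What remains is that the first dart of `we` or `w′e` on the tour has a bad bit.
  improve : ∀ {T d k K} → T ⊆G inc → IsTree T → has inc d ≡ true → Violation T d k → k < K →
            ∃ λ T′ → T′ ⊆G inc × IsTree T′ × SameDegrees T′ T × code T d K < code T′ d K
  improve {T} {d} {k} {K} T⊆inc tree inc-d (T∌g , at-E , unseen) k<K with tour T d k in at-k
  improve {T} {d} {k} {K} T⊆inc tree inc-d (T-we , refl , unseen) k<K | w , e , fromE
    with Rooted.up-exists (root (inj₁ w) tree) (inj₂ e) (λ ())
  ... | (w′ , _ , fromE) , refl , u = T′ , T′⊆inc , isTree , degrees , improved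
    where
    open Rooted (root (inj₁ w) tree)
    c = colour (w′ , e)
    g : Dart n m
    g = w′ , e , fromE
    Tg = up⇒has g u
    cut-g = cut g Tg
    open Exchange {T = T} {w′} {w} {e} {c} tree Tg T-we (Cut-flip cut-g) (up⇒colour g u)
      hiding (connected)
    inc-we : inc w e ≡ true
    inc-we = subst (λ h → has inc h ≡ true) at-k (tour-inc T d inc-d k)
    T′⊆inc : T′ ⊆G inc
    T′⊆inc v a p with edge (v , a , fromV) ≟E (w , e)
    ... | yes refl = inc-we
    ... | no ≢we   = T⊆inc v a (proj₁ (kept⁻ (v , a , fromV) p ≢we))
    Touches : Dart n m → Set
    Touches h = edge h ≡ (w , e) ⊎ edge h ≡ (w′ , e)
    touches? : ∀ i → Dec (Touches (tour T d i))
    touches? i = (_ ≟E _) ⊎-dec (_ ≟E _)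
    good : ∀ t → t < suc k → ∀ h → tour T d t ≡ h → Touches h → bit T h ≡ false × bit T′ h ≡ true
    good t t≤k (_ , _ , fromE) at-t (inj₁ refl) = T-we , new (w , e , fromE) refl
    good t t≤k (_ , _ , fromV) at-t (inj₂ refl) = cong not Tg , cong not (old (w′ , e , fromV) refl)
    -- A visit of `we` from `w` before time `k` contradicts `unseen`, and at time `k` the edge is
    -- seen from `e`.
    good t t≤k (_ , _ , fromV) at-t (inj₁ refl) with m≤n⇒m<n∨m≡n (≤-pred t≤k)
    ... | inj₁ t<k = contradiction (t , t<k , at-t) unseen
    ... | inj₂ refl with trans (sym at-k) at-t
    ... | ()
    -- Had the tour crossed `w′e` from `e` before being at `e` at time `k`, it would have gone all
    -- around the far side, which contains `w`, and seen `we` from there.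
    good t t≤k (_ , _ , fromE) at-t (inj₂ refl) with m≤n⇒m<n∨m≡n (≤-pred t≤k)
    ... | inj₁ t<k = contradiction
      (subtour T⊆inc tree g Tg cut-g at-t t<k (cong (λ h → c (node h)) at-k) (w , e , fromV) inc-we
               (λ { refl → edges-differ refl }) (up⇒colour g u))
      unseen
    ... | inj₂ refl with trans (sym at-k) at-t
    ... | refl = contradiction refl edges-differ
    improved : code T d K < code T′ d K
    improved with least touches? (suc k)
    ... | inj₂ none = contradiction (inj₁ (cong edge at-k)) (none k (n<1+n k))
    ... | inj₁ (t , t≤k , touch , before) with good t t≤k (tour T d t) refl touch
    ... | bad , better = code-improves T T′ d t (≤-trans t≤k k<K)
      (λ i i<t → sym (kept (tour T d i) (λ p → before i i<t (inj₁ p)) λ p → before i i<t (inj₂ p))) bad better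

  -- Improvement ends because all codes of length `K` are below `2 ^ K`.
  jaeger-tree : ∀ {T d} → T ⊆G inc → IsTree T → has inc d ≡ true →
                ∃ λ J → J ⊆G inc × IsTree J × SameDegrees J T × FirstSeenFrom fromV J (tour J d)
  jaeger-tree {T} {d} T⊆inc tree inc-d = go T (<-wellFounded _) T⊆inc tree (λ _ → refl)
    where
    K = dartBound
    go : ∀ U → Acc _<_ (2 ^ K ∸ code U d K) → U ⊆G inc → IsTree U → SameDegrees U T →
         ∃ λ J → J ⊆G inc × IsTree J × SameDegrees J T × FirstSeenFrom fromV J (tour J d)
    go U (acc smaller) U⊆inc treeU degrees with anyUpTo? (violation? U d) K
    ... | yes (k , k<K , violation) with improve U⊆inc treeU inc-d violation k<K
    ... | U′ , U′⊆inc , treeU′ , degrees′ , better =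
      go U′ (smaller (∸-monoʳ-< better (<⇒≤ (code-bound U′ d K)))) U′⊆inc treeU′
         (λ e → trans (degrees′ e) (degrees e))
    go U _ U⊆inc treeU degrees | no none = U , U⊆inc , treeU , degrees , first
      where
      open Period (tour-period U inc-d)
      first : FirstSeenFrom fromV U (tour U d)
      first k U∌g at-E with k <? K
      ... | yes k<K = decidable-stable (anyUpTo? (λ j → tour U d j ≟D _) k)
        λ unseen → none (k , k<K , U∌g , at-E , unseen)
      -- A time `k` not below `K` comes after a full period, in which the flip has been seen.
      ... | no k≮K with coverage U inc-d U⊆inc (proj₂ treeU) (proj₁ treeU _ _) (flip (tour U d k))
                          (tour-inc U d inc-d k) refl
      ... | i , i<p , eq = i , <-≤-trans i<p (≤-trans bounded (≮⇒≥ k≮K)) , eq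

-- The processes follow the tour

module _ {n m : ℕ} {inc : Graph n m} {ordV ordE} (ribbon : IsRibbon inc ordV ordE) where

  open Tour ribbon

  next⇒Skip-V : ∀ {G : Graph n m} {v e e′} → inc v e ≡ true → next (ordV v) e (G v) ≡ just e′ →
                Skip rot (has G) (v , e , fromV) (v , e′ , fromV)
  next⇒Skip-V {G} {v} inc-ve eq = lift (next⇒Skip (uniqueV v) (inc⇒∈V inc-ve) eq)
    where
    lift : ∀ {e e′} → Skip (cyclicSuc (ordV v)) (G v) e e′ → Skip rot (has G) (v , e , fromV) (v , e′ , fromV)
    lift (here p)   = here p
    lift (skip p s) = skip p (lift s)

  next⇒Skip-E : ∀ {G : Graph n m} {v e v′} → inc v e ≡ true → next (ordE e) v (λ x → G x e) ≡ just v′ →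
                Skip rot (has G) (v , e , fromE) (v′ , e , fromE)
  next⇒Skip-E {G} {v} {e} inc-ve eq = lift (next⇒Skip (uniqueE e) (inc⇒∈E inc-ve) eq)
    where
    lift : ∀ {v v′} → Skip (cyclicSuc (ordE e)) (λ x → G x e) v v′ → Skip rot (has G) (v , e , fromE) (v′ , e , fromE)
    lift (here p)   = here p
    lift (skip p s) = skip p (lift s)

  module Follow {J : Graph n m} {d₀ : Dart n m} (J⊆inc : J ⊆G inc) (tree : IsTree J) (inc-d₀ : has inc d₀ ≡ true)
                {f : Fin m → ℕ} (degrees : ∀ e → degE J e ≡ suc (f e)) where

    open Period (tour-period J {d₀} inc-d₀)

    path : ℕ → Dart n m
    path = tour J d₀

    visit : ∀ g → has inc g ≡ true → ∃ λ k → k < period × path k ≡ g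
    visit g inc-g = coverage J {d₀} inc-d₀ J⊆inc (proj₂ tree) (proj₁ tree _ _) g inc-g refl

    -- The process has reached time k of the tour of J with current graph G and traversals tr.
    record Invariant (G : Graph n m) (tr : Trav n m) (k : ℕ) : Set where
      field
        J⊆G      : J ⊆G G
        G⊆inc    : G ⊆G inc
        cleared  : ∀ {i} → i < k → has G (path i) ≡ true → has J (path i) ≡ true
        sound    : ∀ {g} → g ∈ tr → ∃ λ i → i < k × path i ≡ g
        complete : ∀ {i} → i < k → has J (path i) ≡ true → path i ∈ tr

    open Invariant

    extend : ∀ {P : ℕ → Set} {k} → (∀ {i} → i < k → P i) → P k → ∀ {i} → i < suc k → P i
    extend {P} below at i≤k with m≤n⇒m<n∨m≡n (≤-pred i≤k)
    ... | inj₁ i<k  = below i<k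
    ... | inj₂ refl = at

    initial : Invariant inc [] 0
    initial = record
      { J⊆G = J⊆inc ; G⊆inc = λ _ _ p → p ; cleared = λ () ; sound = λ () ; complete = λ () }

    -- The tour also stops at darts of removed edges, which the process skips; only the time
    -- changes.
    pass : ∀ {G tr k} → Invariant G tr k → has G (path k) ≡ false → Invariant G tr (suc k)
    pass {G} {tr} {k} I G∌ = record
      { J⊆G      = J⊆G I
      ; G⊆inc    = G⊆inc I
      ; cleared  = extend {λ i → has G (path i) ≡ true → has J (path i) ≡ true} (cleared I)
                     λ p → contradiction (trans (sym G∌) p) λ ()
      ; sound    = λ g∈ → let i , i<k , eq = sound I g∈ in i , m≤n⇒m≤1+n i<k , eq
      ; complete = extend {λ i → has J (path i) ≡ true → path i ∈ tr} (complete I)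
                     λ p → contradiction (trans (sym G∌) (J⊆G I _ _ p)) λ ()
      }

    traverse : ∀ {G tr k} g → path k ≡ g → Invariant G tr k → has J g ≡ true → Invariant G (g ∷ tr) (suc k)
    traverse {G} {tr} {k} _ refl I J∋ = record
      { J⊆G      = J⊆G I
      ; G⊆inc    = G⊆inc I
      ; cleared  = extend {λ i → has G (path i) ≡ true → has J (path i) ≡ true} (cleared I) λ _ → J∋
      ; sound    = sound′
      ; complete = extend {λ i → has J (path i) ≡ true → path i ∈ path k ∷ tr}
                     (λ i<k p → there (complete I i<k p)) λ _ → here refl
      }
      where
      sound′ : ∀ {g} → g ∈ path k ∷ tr → ∃ λ i → i < suc k × path i ≡ g
      sound′ (here refl) = k , n<1+n k , refl
      sound′ (there g∈) with sound I g∈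
      ... | i , i<k , eq = i , m≤n⇒m≤1+n i<k , eq

    erase : ∀ {G tr k} g → path k ≡ g → Invariant G tr k → has J g ≡ false → Invariant (G ∖ g) tr (suc k)
    erase {G} {tr} {k} g refl I J∌ = record
      { J⊆G      = λ v e p → trans (del-keeps G g (v , e , fromV) (J≢g (v , e , fromV) p)) (J⊆G I v e p)
      ; G⊆inc    = λ v e p → G⊆inc I v e (proj₁ (del-⊆ G g (v , e , fromV) p))
      ; cleared  = extend {λ i → has (G ∖ g) (path i) ≡ true → has J (path i) ≡ true}
                     (λ {i} i<k p → cleared I i<k (proj₁ (del-⊆ G g (path i) p)))
                     λ p → contradiction refl (proj₂ (del-⊆ G g (path k) p))
      ; sound    = λ g∈ → let i , i<k , eq = sound I g∈ in i , m≤n⇒m≤1+n i<k , eq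
      ; complete = extend {λ i → has J (path i) ≡ true → path i ∈ tr} (complete I)
                     λ p → contradiction (trans (sym J∌) p) λ ()
      }
      where
      J≢g : ∀ a → has J a ≡ true → edge a ≢ edge g
      J≢g (v , e , s) p refl = contradiction (trans (sym J∌) p) λ ()

    -- One `next` of the process may be several steps of the tour: the skipped darts are not in `G`,
    -- hence not in `J`, and the tour merely rotates past them.
    advance : ∀ {G tr k g h} → Invariant G tr (suc k) → path (suc k) ≡ rot g → Skip rot (has G) g h →
              ∃ λ k′ → k < k′ × path k′ ≡ h × Invariant G tr k′
    advance {k = k} I eq (here _) = suc k , ≤-refl , eq , I
    advance {G} {k = k} {g} I eq (skip G∌ s)
      with advance (pass I (trans (cong (has G) eq) G∌)) (trans (cong (walk J) eq) (walk-false J (rot g) J∌)) s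
      where
      J∌ : has J (rot g) ≡ false
      J∌ = ¬-not λ p → contradiction (trans (sym G∌) (J⊆G I _ _ p)) λ ()
    ... | k′ , 1+k<k′ , eq′ , I′ = k′ , <⇒≤ 1+k<k′ , eq′ , I′

    advance-tree : ∀ {G tr k h} g → path k ≡ g → Invariant G tr k → has J g ≡ true → Skip rot (has G) (flip g) h →
                   ∃ λ k′ → k < k′ × path k′ ≡ h × Invariant G (g ∷ tr) k′
    advance-tree g at-k I J∋ = advance (traverse g at-k I J∋) (trans (cong (walk J) at-k) (walk-true J g J∋))

    advance-nontree : ∀ {G tr k h} g → path k ≡ g → Invariant G tr k → has J g ≡ false → Skip rot (has (G ∖ g)) g h →
                      ∃ λ k′ → k < k′ × path k′ ≡ h × Invariant (G ∖ g) tr k′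
    advance-nontree g at-k I J∌ = advance (erase g at-k I J∌) (trans (cong (walk J) at-k) (walk-false J g J∌))

    -- Every edge of `G` has been met within the period, and by `cleared` only edges of `J` survive
    -- that.
    finished : ∀ {G tr k} → Invariant G tr k → period ≤ k → ∀ v e → G v e ≡ J v e
    finished {G} I p≤k v e with J v e in Jve | G v e in Gve
    ... | true  | true  = refl
    ... | true  | false = contradiction (trans (sym Gve) (J⊆G I v e Jve)) λ ()
    ... | false | false = refl
    ... | false | true with visit (v , e , fromV) (G⊆inc I v e Gve)
    ... | i , i<p , eq = contradiction
      (trans (sym Jve) (subst (λ g → has J g ≡ true) eq
        (cleared I (<-≤-trans i<p p≤k) (subst (λ g → has G g ≡ true) (sym eq) Gve)))) λ ()

    -- The tour is injective within a period, so the stopping rule cannot fire before the tour is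
    -- complete.
    revisited : ∀ {G tr k} g → path k ≡ g → Invariant G tr k → g ∈ tr → period ≤ k
    revisited {k = k} _ refl I g∈ with sound I g∈
    ... | i , i<k , eq with period ≤? k
    ... | yes p≤k = p≤k
    ... | no p≰k  = contradiction (injective (<-trans i<k (≰⇒> p≰k)) (≰⇒> p≰k) eq) (<⇒≢ i<k)

    revisit : ∀ {G tr k} g → path k ≡ g → Invariant G tr k → has J g ≡ true → period ≤ k → g ∈ tr
    revisit {tr = tr} {k} _ refl I J∋ p≤k with reduce k
    ... | i , i<p , _ , eq = subst (_∈ tr) eq
      (complete I (<-≤-trans i<p p≤k) (trans (cong (has J) eq) J∋))

    J-spanning : ∀ {G} → J ⊆G G → IsHypertree G f
    J-spanning J⊆G′ = J , (J⊆G′ , proj₁ tree , IsTree⇒Acyclic tree) , degrees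

    removable : ∀ {G tr k} g → path k ≡ g → Invariant G tr k → has J g ≡ false → IsHypertree (G ∖ g) f
    removable g eq I J∌ = J-spanning (J⊆G (erase g eq I J∌))

    module _ {s : Side} (first : FirstSeenFrom s J path) where

      -- A non-tree edge would have been met from side `s` before, and been removed. This is why a
      -- process may traverse an edge from its untested side and still follow the tour.
      tree-dart : ∀ {G tr k} g → path k ≡ g → side g ≡ opposite s → Invariant G tr k → has G g ≡ true → has J g ≡ true
      tree-dart {G} {k = k} _ refl opp I G∋ with has J (path k) in Jk
      ... | true = refl
      ... | false with first k Jk opp
      ... | j , j<k , eq = contradiction (trans (sym Jk) (trans (sym (cong (has J) eq))
        (cleared I j<k (trans (cong (has G) eq) G∋)))) λ ()

      -- If a were on the side of g, the tour would pass g a second time between a and flip a.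
      crossing : ∀ {G tr k c} g → path k ≡ g → Invariant G tr k → Cut J g c →
                 ∀ a → side a ≡ s → has (G ∖ g) a ≡ true → c (node a) ≢ c (node (flip a)) → c (node a) ≢ c (node g)
      crossing {G} {tr} {k} {c} g refl I cut a at-s G∋a differ same
        with del-⊆ G g a G∋a
      ... | G∋ , a≢g with visit a (G⊆inc I _ _ G∋) | visit (flip a) (G⊆inc I _ _ G∋)
      ... | j , j<p , refl | j′ , j′<p , eq′ = contradiction at-k (λ l≡k → <-irrefl (sym l≡k) (<-≤-trans k<j j≤l))
        where
        J∌a : has J a ≡ false
        J∌a = ¬-not λ p → differ (respects cut a p a≢g)
        k<j : k < j
        k<j with <-cmp k j
        ... | tri< k<j _ _ = k<j
        ... | tri≈ _ refl _ = contradiction refl a≢g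
        ... | tri> _ _ j<k = contradiction (trans (sym J∌a) (cleared I j<k G∋)) λ ()
        j<j′ : j < j′
        j<j′ with first j′ (trans (cong (has J) eq′) J∌a) (trans (cong side eq′) (cong opposite at-s))
        ... | i , i<j′ , eq with injective (<-trans i<j′ j′<p) j<p (trans eq (trans (cong flip eq′) (flip-flip a)))
        ... | refl = i<j′
        again : ∃ λ l → j ≤ l × l < j′ × path l ≡ g
        again with cross {d₀ = d₀} cut j (j′ ∸ j) same
          (subst (λ i → c (node (path i)) ≢ c (node g)) (sym (m∸n+n≡m (<⇒≤ j<j′)))
            (λ p → differ (trans same (sym (trans (cong (λ h → c (node h)) (sym eq′)) p)))))
        ... | l , j≤l , l< , eq = l , j≤l , subst (l <_) (m∸n+n≡m (<⇒≤ j<j′)) l< , eq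
        l   = proj₁ again
        j≤l = proj₁ (proj₂ again)
        at-k : l ≡ k
        at-k = injective (<-trans (proj₁ (proj₂ (proj₂ again))) j′<p) (<-trans k<j j<p) (proj₂ (proj₂ (proj₂ again)))

      -- By `crossing`, no edge of `G` other than `g` joins an emerald node on the side of the
      -- emerald end of `g` to a violet node on the other side. Both values of `s` lead to this
      -- situation, which `degree-obstruction` refutes for `U`.
      not-removable : ∀ {G tr k} g → path k ≡ g → side g ≡ s → Invariant G tr k → has J g ≡ true →
                      ¬ IsHypertree (G ∖ g) f
      not-removable {G} {k = k} g at-k at-s I J∋ (U , (U⊆ , connU , acyclicU) , degU) with proj₂ tree g J∋
      ... | c , cut = refute g at-k at-s J∋ cut U⊆
        where
        same-degrees : ∀ e → degE J e ≡ degE U e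
        same-degrees e = trans (degrees e) (sym (degU e))
        treeU = Acyclic⇒IsTree connU acyclicU
        refute : ∀ g → path k ≡ g → side g ≡ s → has J g ≡ true → Cut J g c → U ⊆G (G ∖ g) → ⊥
        refute g@(v , e , fromV) at-k refl J∋ cut U⊆ = degree-obstruction tree treeU same-degrees J∋ cut closed
          where
          closed : ∀ v′ e′ → U v′ e′ ≡ true → c (inj₂ e′) ≡ c (inj₂ e) → c (inj₁ v′) ≡ c (inj₂ e)
          closed v′ e′ p inside = decidable-stable (_ ≟B _) λ outside →
            crossing g at-k I cut (v′ , e′ , fromV) refl (U⊆ v′ e′ p) (λ q → outside (trans q inside))
              (trans (Cut-node (Cut-flip cut) outside) refl)
        refute g@(v , e , fromE) at-k refl J∋ cut U⊆ =
          degree-obstruction tree treeU same-degrees J∋ (Cut-flip cut) closed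
          where
          closed : ∀ v′ e′ → U v′ e′ ≡ true → c (inj₂ e′) ≡ c (inj₂ e) → c (inj₁ v′) ≡ c (inj₂ e)
          closed v′ e′ p inside = decidable-stable (_ ≟B _) λ outside →
            crossing g at-k I cut (v′ , e′ , fromE) refl (U⊆ v′ e′ p) (λ q → outside (trans (sym q) inside)) inside

      kept⇒tree : ∀ {G tr k} g → path k ≡ g → Invariant G tr k → ¬ IsHypertree (G ∖ g) f → has J g ≡ true
      kept⇒tree g at-k I keep with has J g in J∋
      ... | true  = refl
      ... | false = contradiction (removable g at-k I J∋) keep

    open Processes inc f ordV ordE

    -- The constructor of the run tells whether `ve` is in `J`: `remove` excludes it by
    -- `not-removable`, the others force it by `kept⇒tree`.
    Run1-follows : FirstSeenFrom fromV J path → ∀ {G tr v e out k} → path k ≡ (v , e , fromV) → Invariant G tr k →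
                   G v e ≡ true → Run1 G tr v e out → ∀ x y → out x y ≡ J x y
    Run1-follows first {G} {v = v} {e} at-k I Gve (remove hyper nxt run) =
      let _ , _ , at-k′ , I′ = advance-nontree (v , e , fromV) at-k I J∌ s
      in Run1-follows first at-k′ I′ (Skip-sat s) run
      where
      J∌ : J v e ≡ false
      J∌ = ¬-not λ J∋ → not-removable first (v , e , fromV) at-k refl I J∋ hyper
      s = next⇒Skip-V {del G v e} (G⊆inc I v e Gve) nxt
    Run1-follows first {v = v} {e} at-k I Gve (stop1 _ seen) = finished I (revisited (v , e , fromV) at-k I seen)
    Run1-follows first {G} {v = v} {e} at-k I Gve (stop2 {w} keep _ nxt seen) =
      let _ , _ , at-k′ , I′ = advance-tree (v , e , fromV) at-k I (kept⇒tree first (v , e , fromV) at-k I keep)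
                                 (next⇒Skip-E {G} (G⊆inc I v e Gve) nxt)
      in finished I′ (revisited (w , e , fromE) at-k′ I′ seen)
    Run1-follows first {G} {v = v} {e} at-k I Gve (step {w} {e′} keep _ nxt _ nxt′ run) =
      let _ , _ , at-k′ , I′ = advance-tree (v , e , fromV) at-k I (kept⇒tree first (v , e , fromV) at-k I keep) s
          _ , _ , at-k″ , I″ = advance-tree (w , e , fromE) at-k′ I′ (tree-dart first (w , e , fromE) at-k′ refl I′ Gwe) s′
      in Run1-follows first at-k″ I″ (Skip-sat s′) run
      where
      s   = next⇒Skip-E {G} (G⊆inc I v e Gve) nxt
      Gwe = Skip-sat s
      s′  = next⇒Skip-V {G} (G⊆inc I w e Gwe) nxt′

    -- Here the run is constructed, by recursion on what is left of the period.
    Run2-exists : FirstSeenFrom fromE J path → ∀ {G tr v e k} → Acc _<_ (period ∸ k) → path k ≡ (v , e , fromE) →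
                  Invariant G tr k → G v e ≡ true → ∃ λ out → Run2 G tr e v out × (∀ x y → out x y ≡ J x y)
    Run2-exists first {G} {tr} {v} {e} {k} (acc smaller) at-k I Gve = by-cases (J v e) refl
      where
      g : Dart n m
      g = v , e , fromE
      closer : ∀ {k′} → k < k′ → k < period → period ∸ k′ < period ∸ k
      closer k<k′ k<p = ≤-<-trans (∸-monoʳ-≤ period k<k′) (∸-monoʳ-< ≤-refl k<p)
      by-cases : ∀ b → J v e ≡ b → ∃ λ out → Run2 G tr e v out × (∀ x y → out x y ≡ J x y)
      by-cases false J∌
        -- A tree edge `we` at `e` survives the removal, so `next` is defined.
        with Rooted.up-exists (root (inj₁ v) tree) (inj₂ e) (λ ())
      ... | (w , _ , fromE) , refl , u =
        let Jwe = Rooted.up⇒has (root (inj₁ v) tree) (w , e , fromE) u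
            _ , nxt = next-just {xs = ordE e} (λ x → del G v e x e) (inc⇒∈E (G⊆inc I v e Gve))
                        (inc⇒∈E (J⊆inc w e Jwe)) (J⊆G (erase g at-k I J∌) w e Jwe)
            s = next⇒Skip-E {del G v e} (G⊆inc I v e Gve) nxt
            _ , k<k′ , at-k′ , I′ = advance-nontree g at-k I J∌ s
            out , run , out≡J = Run2-exists first (smaller (closer k<k′ k<p)) at-k′ I′ (Skip-sat s)
        in out , remove (removable g at-k I J∌) nxt run , out≡J
        where
        k<p : k < period
        -- By `finished`, no non-tree edge is left after a full period.
        k<p = ≰⇒> λ p≤k → contradiction (trans (sym Gve) (trans (finished I p≤k v e) J∌)) λ ()
      by-cases true J∋ with member? _≟D_ g tr
      ... | yes seen = G , stop1 (not-removable first g at-k refl I J∋) seen , finished I (revisited g at-k I seen)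
      ... | no unseen with next-just {xs = ordV v} (G v) (inc⇒∈V (G⊆inc I v e Gve)) (inc⇒∈V (G⊆inc I v e Gve)) Gve
      ... | d , nxt with next⇒Skip-V {G} (G⊆inc I v e Gve) nxt
      ... | s with advance-tree g at-k I J∋ s
      ... | k′ , k<k′ , at-k′ , I′ with member? _≟D_ (v , d , fromV) (g ∷ tr)
      ... | yes seen = G , stop2 keep unseen nxt seen , finished I′ (revisited (v , d , fromV) at-k′ I′ seen)
        where keep = not-removable first g at-k refl I J∋
      ... | no unseen′ =
        let Gvd = Skip-sat s
            _ , nxt′ = next-just {xs = ordE d} (λ x → G x d) (inc⇒∈E (G⊆inc I v d Gvd)) (inc⇒∈E (G⊆inc I v d Gvd)) Gvd
            s′ = next⇒Skip-E {G} (G⊆inc I v d Gvd) nxt′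
            _ , k′<k″ , at-k″ , I″ = advance-tree (v , d , fromV) at-k′ I′
                                       (tree-dart first (v , d , fromV) at-k′ refl I′ Gvd) s′
            -- After a full period `g` would already be recorded, by `revisit`.
            k<p = ≰⇒> λ p≤k → unseen (revisit g at-k I J∋ p≤k)
            out , run , out≡J = Run2-exists first (smaller (closer (<-trans k<k′ k′<k″) k<p)) at-k″ I″ (Skip-sat s′)
        in out , step (not-removable first g at-k refl I J∋) unseen nxt unseen′ nxt′ run , out≡J

-- The reversed tour

module Reversal {n m : ℕ} {inc : Graph n m} {ordV ordE} (ribbon : IsRibbon inc ordV ordE)
                {J : Graph n m} {d₀ : Dart n m} (J⊆inc : J ⊆G inc) (tree : IsTree J) (inc-d₀ : has inc d₀ ≡ true) where

  open Tour ribbon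
  open Period (tour-period J {d₀} inc-d₀)
  module Reverse = Tour (IsRibbon-reverse ribbon)

  path back : ℕ → Dart n m
  path = tour J d₀
  back = Reverse.tour J (rot⁻ d₀)

  -- With τ = rot ∘ twist, the reversed tour applies rot⁻ ∘ twist = twist ∘ τ⁻¹ ∘ twist.
  back-path : ∀ k i → suc k + i ≡ period → back k ≡ twist J (path i)
  back-path zero i eq = begin
    rot⁻ d₀                        ≡⟨ cong rot⁻ returns ⟨
    rot⁻ (path period)             ≡⟨ cong (λ j → rot⁻ (path j)) eq ⟨
    rot⁻ (rot (twist J (path i)))  ≡⟨ rot⁻-rot _ (twist-inc J (path i) (tour-inc J d₀ inc-d₀ i)) ⟩
    twist J (path i)               ∎
    where open ≡-Reasoning
  back-path (suc k) i eq = begin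
    rot⁻ (twist J (back k))                   ≡⟨ cong (λ d → rot⁻ (twist J d)) previous ⟩
    rot⁻ (twist J (twist J (path (suc i))))   ≡⟨ cong rot⁻ (twist-twist J (path (suc i))) ⟩
    rot⁻ (rot (twist J (path i)))             ≡⟨ rot⁻-rot _ (twist-inc J (path i) (tour-inc J d₀ inc-d₀ i)) ⟩
    twist J (path i)                          ∎
    where
    open ≡-Reasoning
    previous : back k ≡ twist J (path (suc i))
    previous = back-path k (suc i) (trans (+-suc (suc k) i) eq)

  rot⁻-inc : has inc (rot⁻ d₀) ≡ true
  rot⁻-inc = Reverse.rot-inc d₀ inc-d₀

  -- Since `twist` fixes non-tree darts, `back` meets them within one turn in the opposite order to
  -- `path`.
  reversed-first : FirstSeenFrom fromV J path → FirstSeenFrom fromE J back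
  reversed-first first k J∌ at-V
    with visited (back k) refl | visited (flip (back k)) refl
    where
    visited : ∀ g → edge g ≡ edge (back k) → ∃ λ i → i < period × path i ≡ g
    visited g refl = coverage J {d₀} inc-d₀ J⊆inc (proj₂ tree) (proj₁ tree _ _) g
                       (Reverse.tour-inc J (rot⁻ d₀) rot⁻-inc k) refl
  ... | i , i<p , eq | i′ , i′<p , eq′
    with first i′ (trans (cong (has J) eq′) J∌) (trans (cong side eq′) (cong opposite at-V))
  ... | j , j<i′ , eqⱼ with injective (<-trans j<i′ i′<p) i<p
                         (trans eqⱼ (trans (cong flip eq′) (trans (flip-flip (back k)) (sym eq))))
  ... | refl =
    k′ , k′<k , trans (back-path k′ i′ k′+i′) (trans (twist-false J (path i′) (trans (cong (has J) eq′) J∌)) eq′)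
    where
    k′ = period ∸ suc i′
    k′+i′ : suc k′ + i′ ≡ period
    k′+i′ = trans (sym (+-suc k′ i′)) (m∸n+n≡m i′<p)
    -- The time `k` may exceed the period. If `k ≤ k′`, however, `back k` is `path l` with `i′ ≤ l`,
    -- whereas `path` meets this dart at time `i < i′`.
    k′<k : k′ < k
    k′<k with k′ <? k
    ... | yes lt = lt
    ... | no k′≮k = contradiction j<i′ (λ lt → <-irrefl refl (<-≤-trans lt (≤-trans i′≤l (≤-reflexive l≡j))))
      where
      k≤k′ = ≮⇒≥ k′≮k
      k<p : k < period
      k<p = ≤-trans (s≤s k≤k′) (≤-trans (m≤m+n (suc k′) i′) (≤-reflexive k′+i′))
      l = period ∸ suc k
      k+l : suc k + l ≡ period
      k+l = m+[n∸m]≡n k<p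
      i′≤l : i′ ≤ l
      i′≤l = ≤-trans (≤-reflexive (trans (sym (m+n∸m≡n (suc k′) i′)) (cong (_∸ suc k′) k′+i′)))
                     (∸-monoʳ-≤ period (s≤s k≤k′))
      l<p : l < period
      l<p = ∸-monoʳ-< z<s k<p
      path-l : path l ≡ back k
      path-l = trans (sym (twist-twist J (path l))) (trans (cong (twist J) (sym (back-path k l k+l)))
                                                            (twist-false J (back k) J∌))
      l≡j : l ≡ i
      l≡j = injective l<p i<p (trans path-l (sym eq))

-- Assembly for a violet and for an emerald base node

theorem6p20 : ∀ {n m} (inc : Graph n m) (ordV : Fin n → List (Fin m)) (ordE : Fin m → List (Fin n))
    (b0 b1 : Node n m) (f : Fin m → ℕ) (T : Graph n m) →
    IsConnectedHypergraph inc → IsRibbon inc ordV ordE → Adj inc b0 b1 →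
    IsHypertree inc f →
    Processes.Outcome1 inc f ordV ordE b0 b1 T →
    Σ (Node n m) λ b1' → PrevBase inc ordV ordE b0 b1 b1' ×
    (Σ (Graph n m) λ T' → Processes.Outcome2 inc f (revV ordV) (revE ordE) b0 b1' T' ×
    (∀ v e → T' v e ≡ T v e))
theorem6p20 {n} {m} inc ordV ordE (inj₁ v) (inj₂ e) f T _ ribbon inc-ve
            (T₀ , (T₀⊆inc , conn , acyclic) , deg) (Processes.baseV run)
  with JaegerTree.jaeger-tree ribbon {d = v , e , fromV} T₀⊆inc (Acyclic⇒IsTree conn acyclic) inc-ve
... | J , J⊆inc , tree , deg′ , first =
  -- The base edge counts as traversed from `v`, so the second process joins its tour after one tree
  -- dart.
  let _ , k<k′ , at-k′ , I′ = B.advance-tree d₁ refl B.initial J∋ s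
      out , run2 , out≡J = B.Run2-exists reversed (<-wellFounded _) at-k′ I′ (Skip-sat s)
  in inj₂ e₁ , next-first (inc v) (R.inc⇒∈V inc-ve) inc-d₁ , out , Processes.baseV (proj₂ nxt) run2 ,
     λ x y → trans (out≡J x y) (sym (T≡J x y))
  where
  module R = Tour (IsRibbon-reverse ribbon)
  degrees : ∀ e → degE J e ≡ suc (f e)
  degrees e = trans (deg′ e) (deg e)
  module A = Follow ribbon {d₀ = v , e , fromV} J⊆inc tree inc-ve {f} degrees
  T≡J = A.Run1-follows first refl A.initial inc-ve run
  e₁ = cyclicSuc (reverse (ordV v)) e
  d₁ : Dart n m
  d₁ = v , e₁ , fromV
  inc-d₁ : inc v e₁ ≡ true
  inc-d₁ = R.rot-inc (v , e , fromV) inc-ve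
  reversed = Reversal.reversed-first ribbon {d₀ = v , e , fromV} J⊆inc tree inc-ve first
  module B = Follow (IsRibbon-reverse ribbon) {d₀ = d₁} J⊆inc tree inc-d₁ {f} degrees
  -- At time 0 nothing has been seen, so on an emerald-first tour a violet starting dart must belong
  -- to `J`.
  J∋ : J v e₁ ≡ true
  J∋ = B.tree-dart reversed d₁ refl refl B.initial inc-d₁
  nxt = next-just {xs = reverse (ordE e₁)} (λ x → inc x e₁) (R.inc⇒∈E inc-d₁) (R.inc⇒∈E inc-d₁) inc-d₁
  s = next⇒Skip-E (IsRibbon-reverse ribbon) {inc} inc-d₁ (proj₂ nxt)
theorem6p20 {n} {m} inc ordV ordE (inj₂ e) (inj₁ v) f T _ ribbon inc-ve
            (T₀ , (T₀⊆inc , conn , acyclic) , deg) (Processes.baseE nxt run)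
  with JaegerTree.jaeger-tree ribbon {d = v , e , fromE} T₀⊆inc (Acyclic⇒IsTree conn acyclic) inc-ve
... | J , J⊆inc , tree , deg′ , first =
  let out , run2 , out≡J = B.Run2-exists reversed (<-wellFounded _) refl B.initial inc-d₁
  in inj₁ v₁ , next-first (λ x → inc x e) (R.inc⇒∈E inc-ve) inc-d₁ , out , Processes.baseE run2 ,
     λ x y → trans (out≡J x y) (sym (T≡J x y))
  where
  module R = Tour (IsRibbon-reverse ribbon)
  degrees : ∀ e → degE J e ≡ suc (f e)
  degrees e = trans (deg′ e) (deg e)
  d₀ : Dart n m
  d₀ = v , e , fromE
  module A = Follow ribbon {d₀ = d₀} J⊆inc tree inc-ve {f} degrees
  T≡J : ∀ x y → T x y ≡ J x y
  T≡J = let s = next⇒Skip-V ribbon {inc} inc-ve nxt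
            -- With an emerald base it is the first process that starts on its untested side, again
            -- at an edge of `J`.
            J∋ = A.tree-dart first d₀ refl refl A.initial inc-ve
            _ , _ , at-k , I = A.advance-tree d₀ refl A.initial J∋ s
        in A.Run1-follows first at-k I (Skip-sat s) run
  v₁ = cyclicSuc (reverse (ordE e)) v
  inc-d₁ : inc v₁ e ≡ true
  inc-d₁ = R.rot-inc d₀ inc-ve
  reversed = Reversal.reversed-first ribbon {d₀ = d₀} J⊆inc tree inc-ve first
  module B = Follow (IsRibbon-reverse ribbon) {d₀ = v₁ , e , fromE} J⊆inc tree inc-d₁ {f} degrees
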